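{- For integers $k$ with $4\leq k\leq 37$ and prime powers $q$, the following is the complete list of all pairs $(k,q)$ for which $\gamma(k,q)$ exists and $\gamma(k,q)\geq 7$, together with the values: $\gamma(8,17)=8$; $\gamma(9,19)=9$; $\gamma(10,11)=10$; $\gamma(11,23)=11$; $\gamma(12,13)=12$; $\gamma(14,29)=14$; $\gamma(15,31)=15$; $\gamma(16,17)=16$; $\gamma(18,73)=7$, $\gamma(18,19)=18$, $\gamma(18,37)=18$; $\gamma(20,121)=7$, $\gamma(20,61)=8$, $\gamma(20,11)=10$, $\gamma(20,41)=20$; $\gamma(21,43)=21$; $\gamma(22,89)=7$, $\gamma(22,67)=8$, $\gamma(22,23)=22$; $\gamma(23,139)=7$, $\gamma(23,47)=23$; $\gamma(24,17)=8$, $\gamma(24,73)=8$, $\gamma(24,97)=8$, $\gamma(24,13)=12$; $\gamma(25,151)=7$, $\gamma(25,101)=9$; $\gamma(26,157)=8$, $\gamma(26,79)=9$, $\gamma(26,53)=26$; $\gamma(27,163)=8$, $\gamma(27,19)=9$, $\gamma(27,109)=9$; $\gamma(28,113)=7$, $\gamma(28,29)=28$; $\gamma(29,59)=29$; $\gamma(30,181)=8$, $\gamma(30,11)=10$, $\gamma(30,121)=10$, $\gamma(30,31)=30$, $\gamma(30,61)=30$; $\gamma(32,193)=8$, $\gamma(32,97)=10$, $\gamma(32,17)=16$; $\gamma(33,199)=9$, $\gamma(33,23)=11$, $\gamma(33,67)=33$; $\gamma(34,103)=10$, $\gamma(34,137)=10$; $\gamma(35,211)=9$, $\gamma(35,71)=35$;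 $\gamma(36,181)=7$, $\gamma(36,109)=11$, $\gamma(36,13)=12$, $\gamma(36,19)=18$, $\gamma(36,37)=36$, $\gamma(36,73)=36$; $\gamma(37,149)=9$, $\gamma(37,223)=9$.
   Context: For a positive integer $k$ and a prime power $q$, $\gamma(k,q)$ denotes the smallest positive integer $m$ such that every element of the finite field $\mathbb{F}_q$ with $q$ elements can be written as a sum of $m$ many $k$-th powers of elements of $\mathbb{F}_q$ ($0$ being a $k$-th power); it does not exist if some element of $\mathbb{F}_q$ is not a sum of $k$-th powers. -}

module Defs where

open import Algebra.Apartness.Bundles using (HeytingField; HeytingCommutativeRing)
open import Algebra.Bundles using (CommutativeRing)
import Algebra.Properties.Monoid.Sum as Sum
import Algebra.Properties.Semiring.Exp as Exp
open import Data.Fin.Base using (Fin)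
open import Data.List.Base using (List; []; _∷_)
open import Data.Nat.Base as ℕ using (ℕ; _≤_)
open import Data.Nat.Primality using (Prime)
open import Data.Product.Base using (_×_; _,_; ∃-syntax; Σ-syntax)
open import Data.Vec.Functional using (Vector)
open import Function.Bundles using (Inverse)
open import Level using (Level; _⊔_; suc)
open import Relation.Binary.PropositionalEquality using (_≡_; setoid)

IsPrimePower : ℕ → Set
IsPrimePower q = ∃[ p ] ∃[ n ] (Prime p × 1 ≤ n × q ≡ p ℕ.^ n)

-- The bijection with Fin q makes _≈_ and invertibility decidable, so that
-- x # y is equivalent to ¬ (x ≈ y): over a finite carrier a Heyting field is
-- the same thing as a field in the classical sense.
record FiniteField (q : ℕ) (c ℓ₁ ℓ₂ : Level) : Set (suc (c ⊔ ℓ₁ ⊔ ℓ₂)) where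
  field
    heytingField : HeytingField c ℓ₁ ℓ₂

  open HeytingCommutativeRing (HeytingField.heytingCommutativeRing heytingField) public
    using (commutativeRing)

  field
    enumeration : Inverse (CommutativeRing.setoid commutativeRing) (setoid (Fin q))

module _ {q : ℕ} {c ℓ₁ ℓ₂ : Level} (F : FiniteField q c ℓ₁ ℓ₂) where

  open CommutativeRing (FiniteField.commutativeRing F)
    using (Carrier; _≈_; semiring; +-monoid)
  open Exp semiring using (_^_)
  open Sum +-monoid using (sum)

  IsSumOfPowers : (k m : ℕ) → Carrier → Set (c ⊔ ℓ₁)
  IsSumOfPowers k m x = Σ[ v ∈ Vector Carrier m ] sum (λ i → v i ^ k) ≈ x

  EveryElementIsSumOfPowers : (k m : ℕ) → Set (c ⊔ ℓ₁)
  EveryElementIsSumOfPowers k m = ∀ x → IsSumOfPowers k m x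

  -- IsWaringNumber k m says that γ(k,q) exists and is equal to m.
  -- Finite fields of equal order are isomorphic, so for a given q
  -- this does not depend on F.
  record IsWaringNumber (k m : ℕ) : Set (c ⊔ ℓ₁) where
    field
      positive   : 1 ≤ m
      sufficient : EveryElementIsSumOfPowers k m
      least      : ∀ n → 1 ≤ n → EveryElementIsSumOfPowers k n → m ≤ n

-- An entry (k , q , m) stands for γ(k,q) = m.
largeWaringNumbers : List (ℕ × ℕ × ℕ)
largeWaringNumbers =
  (8 , 17 , 8) ∷
  (9 , 19 , 9) ∷
  (10 , 11 , 10) ∷
  (11 , 23 , 11) ∷
  (12 , 13 , 12) ∷
  (14 , 29 , 14) ∷
  (15 , 31 , 15) ∷
  (16 , 17 , 16) ∷
  (18 , 73 , 7) ∷ (18 , 19 , 18) ∷ (18 , 37 , 18) ∷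
  (20 , 121 , 7) ∷ (20 , 61 , 8) ∷ (20 , 11 , 10) ∷ (20 , 41 , 20) ∷
  (21 , 43 , 21) ∷
  (22 , 89 , 7) ∷ (22 , 67 , 8) ∷ (22 , 23 , 22) ∷
  (23 , 139 , 7) ∷ (23 , 47 , 23) ∷
  (24 , 17 , 8) ∷ (24 , 73 , 8) ∷ (24 , 97 , 8) ∷ (24 , 13 , 12) ∷
  (25 , 151 , 7) ∷ (25 , 101 , 9) ∷
  (26 , 157 , 8) ∷ (26 , 79 , 9) ∷ (26 , 53 , 26) ∷
  (27 , 163 , 8) ∷ (27 , 19 , 9) ∷ (27 , 109 , 9) ∷
  (28 , 113 , 7) ∷ (28 , 29 , 28) ∷
  (29 , 59 , 29) ∷
  (30 , 181 , 8) ∷ (30 , 11 , 10) ∷ (30 , 121 , 10) ∷ (30 , 31 , 30) ∷ (30 , 61 , 30) ∷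
  (32 , 193 , 8) ∷ (32 , 97 , 10) ∷ (32 , 17 , 16) ∷
  (33 , 199 , 9) ∷ (33 , 23 , 11) ∷ (33 , 67 , 33) ∷
  (34 , 103 , 10) ∷ (34 , 137 , 10) ∷
  (35 , 211 , 9) ∷ (35 , 71 , 35) ∷
  (36 , 181 , 7) ∷ (36 , 109 , 11) ∷ (36 , 13 , 12) ∷ (36 , 19 , 18) ∷ (36 , 37 , 36) ∷ (36 , 73 , 36) ∷
  (37 , 149 , 9) ∷ (37 , 223 , 9) ∷
  []

{-# OPTIONS --safe #-}

-- Put d = gcd(k, q − 1) and q = dn + 1.  The k-th powers of F_q are its d-th powers; let A be
-- their set and sA the set of sums of s of them.
--
-- If n(n + 1) > d²(d − 1), then 6A = F_q.  Indeed, for f, g : F_q → ℤ with Σ f = 0, the function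
-- N(m, t) = Σ_v g(v) f(t + mv) satisfies Σ_{m,t} N(m, t)² = q ‖f‖² ‖g‖².  If g is invariant under
-- multiplication by nonzero d-th powers, then Σ_t N(m, t)² takes the same value at all d-th powers
-- m ≠ 0, and each of these has at most d roots.  Taking for f the centred indicator of sA and for
-- g the indicator of −A gives, by Cauchy–Schwarz,
--   (q − 1) |A| |sA| (q − |(s+1)A|) ≤ d q |(s+1)A| (q − |sA|).
-- The cases s = 1 and s = 2 imply |3A| > q/2, hence 3A + 3A = F_q.
--
-- For d ≤ 37 this leaves finitely many q.  There a breadth-first search adds one power at a time
-- to representatives of the cosets of the group of nonzero d-th powers; two elements lie in the
-- same coset iff their n-th powers agree.  The arithmetic is that of ℤ/q for a prime q, and that
-- of F_p[X]/(f) otherwise; f has a root in every field with q elements because it divides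
-- X^(q−1) − 1.

module Submission where

-- The field of the theorem is abstract, so the search cannot run in it. It runs in a concrete
-- arithmetic that is tied to the field by a homomorphism: ℤ/q maps to it because q times 1 vanishes
-- there, and F_p[X]/(f) because X can be sent to a root of f. Positive equality tests carry over
-- along such a map, negative ones do not, as the map is not known to be injective. Hence every
-- inequality is certified by an equation: x^(q-1) = 1 excludes x = 0.
--
-- The search acts as a producer of certificates. Its table is checked afterwards: the orders of θⁿ
-- and θᵈ, that all cosets occur, that adding a power raises the level by at most one, and that a
-- witness avoids the lower levels. A failed check gives the verdict `invalid`, which the final
-- evaluation excludes. The closure check yields the lower bounds, and also the case where γ(k,q)
-- does not exist because the d-th powers lie in a proper subfield.

-- Integer sums over finite index sets, indicators and counting.

module IntegerSums where
  import Algebra.Properties.Semiring.Sum as SemiringSum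
  open import Data.Bool.Base using (true; false; if_then_else_)
  open import Data.Fin.Base as Fin using (Fin; punchIn)
  open import Data.Fin.Permutation using (Permutation; _⟨$⟩ʳ_)
  import Data.Fin.Properties as Fin
  open import Data.Integer.Base as ℤ using (ℤ; 0ℤ; 1ℤ; _+_; _*_; _-_; -_; _≤_; +≤+) renaming (+_ to pos)
  import Data.Integer.Properties as ℤ
  open import Data.Integer.Tactic.RingSolver using (solve-∀)
  open import Data.List.Base using (length; filter; allFin; tabulate)
  open import Data.Nat.Base as ℕ using (ℕ; zero; suc; z≤n)
  import Data.Nat.Properties as ℕ
  import Data.List.Properties as List
  open import Data.List.Membership.Propositional.Properties using (∈-filter⁺; ∈-allFin; ∈-length)
  open import Data.List.Relation.Unary.All using (All)
  import Data.List.Relation.Unary.All.Properties as All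
  open import Data.List.Relation.Unary.Unique.Propositional using (Unique)
  import Data.List.Relation.Unary.Unique.Propositional.Properties as Unique
  open import Data.Product.Base using (_×_; _,_; ∃-syntax)
  open import Function.Base using (_∘_; id)
  open import Level using (Level)
  open import Relation.Binary.PropositionalEquality
  open import Relation.Nullary using (Dec; yes; no; does; contradiction; ¬_)
  open import Relation.Unary using (Pred; Decidable)
  open import Algebra.Bundles using (CommutativeRing)

  private
    module S = SemiringSum (CommutativeRing.semiring ℤ.+-*-commutativeRing)

  -- Opaque, so that unification can see through equations between sums.
  opaque
    sum : ∀ {n} → (Fin n → ℤ) → ℤ
    sum = S.sum

    sum-zero : (f : Fin 0 → ℤ) → sum f ≡ 0ℤ
    sum-zero f = refl

    sum-suc : ∀ {n} (f : Fin (suc n) → ℤ) → sum f ≡ f Fin.zero + sum (f ∘ Fin.suc)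
    sum-suc f = refl

    sum-cong : ∀ {n} {f g : Fin n → ℤ} → (∀ i → f i ≡ g i) → sum f ≡ sum g
    sum-cong = S.sum-cong-≗

    sum-remove : ∀ {n} (f : Fin (suc n) → ℤ) i → sum f ≡ f i + sum (λ j → f (punchIn i j))
    sum-remove f i = S.sum-remove {i = i} f

    sum-permute : ∀ {n} (f : Fin n → ℤ) (π : Permutation n n) → sum f ≡ sum (λ i → f (π ⟨$⟩ʳ i))
    sum-permute = S.sum-permute

    sum-swap : ∀ {m n} (f : Fin m → Fin n → ℤ) → sum (λ i → sum (f i)) ≡ sum (λ j → sum (λ i → f i j))
    sum-swap = S.∑-comm

    sum-+ : ∀ {n} (f g : Fin n → ℤ) → sum (λ i → f i + g i) ≡ sum f + sum g
    sum-+ = S.∑-distrib-+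

    sum-*ˡ : ∀ {n} c (f : Fin n → ℤ) → sum (λ i → c * f i) ≡ c * sum f
    sum-*ˡ c f = sym (S.*-distribˡ-sum c f)

    sum-*ʳ : ∀ {n} (f : Fin n → ℤ) c → sum (λ i → f i * c) ≡ sum f * c
    sum-*ʳ f c = sym (S.*-distribʳ-sum c f)

  sum-cong₂ : ∀ {m n} {f g : Fin m → Fin n → ℤ} → (∀ i j → f i j ≡ g i j) →
              sum (λ i → sum (f i)) ≡ sum (λ i → sum (g i))
  sum-cong₂ f≗g = sum-cong (λ i → sum-cong (f≗g i))

  square-nonneg : ∀ i → 0ℤ ≤ i * i
  square-nonneg (pos n)      = subst (0ℤ ≤_) (ℤ.pos-* n n) (+≤+ z≤n)
  square-nonneg ℤ.-[1+ n ] = +≤+ z≤n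

  *-monoˡ : ∀ {i j k} → 0ℤ ≤ i → j ≤ k → i * j ≤ i * k
  *-monoˡ {i} 0≤i = ℤ.*-monoˡ-≤-nonNeg i {{ℤ.nonNegative 0≤i}}

  *-cancel-≤ : ∀ {i j k} → 0ℤ ℤ.< i → i * j ≤ i * k → j ≤ k
  *-cancel-≤ {i} {j} {k} 0<i = ℤ.*-cancelˡ-≤-pos j k i {{ℤ.positive 0<i}}

  sum-mono : ∀ {n} {f g : Fin n → ℤ} → (∀ i → f i ≤ g i) → sum f ≤ sum g
  sum-mono {zero}  {f} {g} f≤g = ℤ.≤-reflexive (trans (sum-zero f) (sym (sum-zero g)))
  sum-mono {suc n} {f} {g} f≤g = subst₂ _≤_ (sym (sum-suc f)) (sym (sum-suc g))
    (ℤ.+-mono-≤ (f≤g Fin.zero) (sum-mono (f≤g ∘ Fin.suc)))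

  sum-const : ∀ n c → sum {n} (λ _ → c) ≡ pos n * c
  sum-const zero    c = trans (sum-zero _) (sym (ℤ.*-zeroˡ c))
  sum-const (suc n) c = begin
    sum {suc n} (λ _ → c)  ≡⟨ sum-suc _ ⟩
    c + sum {n} (λ _ → c)  ≡⟨ cong (c +_) (sum-const n c) ⟩
    c + pos n * c          ≡⟨ unfold (pos n) c ⟩
    (1ℤ + pos n) * c       ≡⟨ cong (_* c) (ℤ.pos-+ 1 n) ⟨
    pos (suc n) * c        ∎
    where
    open ≡-Reasoning
    unfold : ∀ m c → c + m * c ≡ (1ℤ + m) * c
    unfold = solve-∀

  sum-0 : ∀ n → sum {n} (λ _ → 0ℤ) ≡ 0ℤ
  sum-0 n = trans (sum-const n 0ℤ) (ℤ.*-zeroʳ (pos n))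

  sum-nonneg : ∀ {n} {f : Fin n → ℤ} → (∀ i → 0ℤ ≤ f i) → 0ℤ ≤ sum f
  sum-nonneg {n} {f} 0≤f = subst (_≤ sum f) (sum-0 n) (sum-mono 0≤f)

  sum-single : ∀ {n} (f : Fin n → ℤ) i → (∀ j → j ≢ i → f j ≡ 0ℤ) → sum f ≡ f i
  sum-single {suc n} f i f≡0 = begin
    sum f                              ≡⟨ sum-remove f i ⟩
    f i + sum (λ j → f (punchIn i j))  ≡⟨ cong (f i +_) (sum-cong (λ j → f≡0 _ (Fin.punchInᵢ≢i i j))) ⟩
    f i + sum {n} (λ _ → 0ℤ)           ≡⟨ cong (f i +_) (sum-0 n) ⟩
    f i + 0ℤ                           ≡⟨ ℤ.+-identityʳ (f i) ⟩
    f i                                ∎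
    where open ≡-Reasoning

  sum-linear : ∀ {n} α β (x y : Fin n → ℤ) → sum (λ i → α * x i - β * y i) ≡ α * sum x - β * sum y
  sum-linear α β x y = begin
    sum (λ i → α * x i - β * y i)                      ≡⟨ sum-cong (λ i → cong (α * x i +_) (ℤ.neg-distribˡ-* β (y i))) ⟩
    sum (λ i → α * x i + - β * y i)                    ≡⟨ sum-+ _ _ ⟩
    sum (λ i → α * x i) + sum (λ i → - β * y i)        ≡⟨ cong₂ _+_ (sum-*ˡ α x) (sum-*ˡ (- β) y) ⟩
    α * sum x + - β * sum y                            ≡⟨ cong (α * sum x +_) (ℤ.neg-distribˡ-* β (sum y)) ⟨
    α * sum x - β * sum y                              ∎
    where open ≡-Reasoning

  -- Serves three times in the energy method: for the norm of the centred indicator, for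
  -- Cauchy-Schwarz and for the value of the energy.
  sum-quadratic : ∀ {n} α β (x y : Fin n → ℤ) →
    sum (λ i → (α * x i - β * y i) * (α * x i - β * y i)) ≡
    α * α * sum (λ i → x i * x i) - pos 2 * (α * β) * sum (λ i → x i * y i) + β * β * sum (λ i → y i * y i)
  sum-quadratic α β x y = begin
    sum (λ i → (α * x i - β * y i) * (α * x i - β * y i))
      ≡⟨ sum-cong (λ i → expand α β (x i) (y i)) ⟩
    sum (λ i → (α * α * (x i * x i) + c * (x i * y i)) + β * β * (y i * y i))
      ≡⟨ sum-+ _ _ ⟩
    sum (λ i → α * α * (x i * x i) + c * (x i * y i)) + sum (λ i → β * β * (y i * y i))
      ≡⟨ cong (_+ sum (λ i → β * β * (y i * y i))) (sum-+ _ _) ⟩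
    sum (λ i → α * α * (x i * x i)) + sum (λ i → c * (x i * y i)) + sum (λ i → β * β * (y i * y i))
      ≡⟨ cong₂ _+_ (cong₂ _+_ (sum-*ˡ (α * α) _) (sum-*ˡ c _)) (sum-*ˡ (β * β) _) ⟩
    α * α * sum (λ i → x i * x i) + c * sum (λ i → x i * y i) + β * β * sum (λ i → y i * y i)
      ≡⟨ collect α β _ _ _ ⟩
    α * α * sum (λ i → x i * x i) - pos 2 * (α * β) * sum (λ i → x i * y i) + β * β * sum (λ i → y i * y i) ∎
    where
    open ≡-Reasoning
    c = - (pos 2 * (α * β))
    expand : ∀ α β x y → (α * x - β * y) * (α * x - β * y) ≡
             α * α * (x * x) + - (pos 2 * (α * β)) * (x * y) + β * β * (y * y)
    expand = solve-∀
    collect : ∀ α β p q s → α * α * p + - (pos 2 * (α * β)) * q + β * β * s ≡ α * α * p - pos 2 * (α * β) * q + β * β * s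
    collect = solve-∀

  private variable
    p : Level
    A B : Set p

  𝟙 : Dec A → ℤ
  𝟙 a? = if does a? then 1ℤ else 0ℤ

  𝟙-yes : (a? : Dec A) → A → 𝟙 a? ≡ 1ℤ
  𝟙-yes (yes _) a = refl
  𝟙-yes (no ¬a) a = contradiction a ¬a

  𝟙-no : (a? : Dec A) → ¬ A → 𝟙 a? ≡ 0ℤ
  𝟙-no (yes a) ¬a = contradiction a ¬a
  𝟙-no (no _)  ¬a = refl

  𝟙-idem : (a? : Dec A) → 𝟙 a? * 𝟙 a? ≡ 𝟙 a?
  𝟙-idem (yes _) = refl
  𝟙-idem (no _)  = refl

  𝟙-nonneg : (a? : Dec A) → 0ℤ ≤ 𝟙 a?
  𝟙-nonneg (yes _) = +≤+ z≤n
  𝟙-nonneg (no _)  = +≤+ z≤n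

  𝟙-mono : (a? : Dec A) (b? : Dec B) → (A → B) → 𝟙 a? ≤ 𝟙 b?
  𝟙-mono (no _)  b?      f = 𝟙-nonneg b?
  𝟙-mono (yes _) (yes _) f = ℤ.≤-refl
  𝟙-mono (yes a) (no ¬b) f = contradiction (f a) ¬b

  𝟙-cong : (a? : Dec A) (b? : Dec B) → (A → B) → (B → A) → 𝟙 a? ≡ 𝟙 b?
  𝟙-cong a? b? f g = ℤ.≤-antisym (𝟙-mono a? b? f) (𝟙-mono b? a? g)

  opaque
    -- Opaque, because the predicates counted later are decided by exhaustive search over the field,
    -- which must not be evaluated during type checking.
    count : ∀ {n} {P : Pred (Fin n) p} → Decidable P → ℕ
    count {n = n} P? = length (filter P? (allFin n))

    sum-𝟙 : ∀ {n} {P : Pred (Fin n) p} (P? : Decidable P) → sum (λ i → 𝟙 (P? i)) ≡ pos (count P?)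
    sum-𝟙 {n = n} {P} P? = go id
      where
      go : ∀ {m} (f : Fin m → Fin n) → sum (λ i → 𝟙 (P? (f i))) ≡ pos (length (filter P? (tabulate f)))
      go {zero}  f = sum-zero (λ i → 𝟙 (P? (f i)))
      go {suc m} f = trans (sum-suc (λ i → 𝟙 (P? (f i)))) (step (does (P? (f Fin.zero))) refl)
        where
        -- Both `𝟙` and `filter` branch on `does`, so its value is what has to be abstracted.
        step : ∀ b → does (P? (f Fin.zero)) ≡ b → 𝟙 (P? (f Fin.zero)) + sum (λ i → 𝟙 (P? (f (Fin.suc i)))) ≡
               pos (length (filter P? (tabulate f)))
        step true eq rewrite eq = trans (cong (1ℤ +_) (go (f ∘ Fin.suc))) (sym (ℤ.pos-+ 1 _))
        step false eq rewrite eq = trans (ℤ.+-identityˡ _) (go (f ∘ Fin.suc))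

    count-positive : ∀ {n} {P : Pred (Fin n) p} (P? : Decidable P) {x} → P x → 1 ℕ.≤ count P?
    count-positive P? {x} px = ∈-length (∈-filter⁺ P? (∈-allFin x) px)

    count-≤ : ∀ {n} {P : Pred (Fin n) p} (P? : Decidable P) → count P? ℕ.≤ n
    count-≤ {n = n} P? = subst (count P? ℕ.≤_) (List.length-tabulate {n = n} id) (List.length-filter P? (allFin n))

    count-list : ∀ {n} {P : Pred (Fin n) p} (P? : Decidable P) →
      ∃[ xs ] Unique xs × All P xs × length xs ≡ count P?
    count-list {n = n} P? =
      filter P? (allFin n) , Unique.filter⁺ P? (Unique.allFin⁺ n) , All.all-filter P? (allFin n) , refl

-- Finite fields on `Fin (suc r)`: Fermat, roots of polynomials, orders, sums of powers.

module Fields where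
  open import Algebra.Bundles using (CommutativeRing)
  open import Algebra.Structures using (IsCommutativeRing)
  import Algebra.Properties.CommutativeMonoid.Sum as CommutativeMonoidSum
  import Algebra.Properties.CommutativeSemiring.Exp as Exponentiation
  import Algebra.Properties.Group as GroupProperties
  import Algebra.Solver.Ring.NaturalCoefficients.Default as SemiringSolver
  import Algebra.Properties.Ring as RingProperties
  open import Data.Fin.Base as Fin using (Fin; toℕ; punchIn)
  open import Data.Fin.Permutation using (Permutation; permutation)
  import Data.Fin.Properties as Fin
  open import Data.List.Base as List using (List; []; _∷_; length; replicate; tabulate)
  import Data.List.Properties as List
  open import Data.List.Relation.Unary.All as All using (All; []; _∷_)
  import Data.List.Relation.Unary.All.Properties as All
  open import Data.List.Relation.Unary.AllPairs using ([]; _∷_)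
  open import Data.List.Relation.Unary.Unique.Propositional using (Unique)
  import Data.List.Relation.Unary.Unique.Propositional.Properties as Unique
  open import Data.Nat.Base as ℕ using (ℕ; zero; suc; _≤_; _<_; z≤n; s≤s; _∸_)
  import Data.Nat.Properties as ℕ
  open import Data.Product.Base using (_×_; _,_; ∃-syntax)
  open import Function.Base using (_∘_)
  open import Level using (0ℓ)
  open import Relation.Binary.PropositionalEquality
  open import Relation.Binary.Definitions using (tri<; tri≈; tri>)
  open import Relation.Nullary using (Dec; yes; no; contradiction)
  open import Relation.Nullary.Decidable using (_×-dec_)

  record FieldOn (K : Set) : Set where
    infixl 6 _+_
    infixl 7 _*_
    infix 8 -_
    field
      _+_ _*_           : K → K → K
      -_                : K → K
      0# 1#             : K
      isCommutativeRing : IsCommutativeRing _≡_ _+_ _*_ -_ 0# 1#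
      inverse           : ∀ x → x ≢ 0# → ∃[ y ] x * y ≡ 1#
      1≢0               : 1# ≢ 0#

    commutativeRing : CommutativeRing 0ℓ 0ℓ
    commutativeRing = record { isCommutativeRing = isCommutativeRing }

  module FiniteFieldTheory {r : ℕ} (F : FieldOn (Fin (suc r))) where

    K : Set
    K = Fin (suc r)

    open FieldOn F public using (_+_; _*_; -_; 0#; 1#; inverse; 1≢0)
    open CommutativeRing (FieldOn.commutativeRing F) public
      using ( +-identityˡ; +-identityʳ; *-identityˡ; *-identityʳ; zeroˡ; zeroʳ
            ; *-comm; *-assoc; +-comm; +-assoc; -‿inverseˡ; -‿inverseʳ; distribˡ; distribʳ
            ; commutativeSemiring; +-commutativeMonoid; *-commutativeMonoid)
    open SemiringSolver commutativeSemiring public using (solve; _:+_; _:*_; _:=_)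
    open Exponentiation commutativeSemiring public
      using (_^_; ^-homo-*; ^-assocʳ; ^-distrib-*)
    open GroupProperties (CommutativeRing.+-group (FieldOn.commutativeRing F)) public
      using () renaming (∙-cancelˡ to +-cancelˡ; ∙-cancelʳ to +-cancelʳ)
    open RingProperties (CommutativeRing.ring (FieldOn.commutativeRing F)) public
      using (-‿distribʳ-*; -‿involutive)
    module ∏ = CommutativeMonoidSum *-commutativeMonoid
    module ∑ᴷ = CommutativeMonoidSum +-commutativeMonoid

    open ≡-Reasoning

    *-cancelˡ : ∀ {x} y z → x ≢ 0# → x * y ≡ x * z → y ≡ z
    *-cancelˡ {x} y z x≢0 xy≡xz with inverse x x≢0
    ... | x⁻¹ , xx⁻¹≡1 = begin
      y              ≡⟨ lemma y ⟩
      x⁻¹ * (x * y)  ≡⟨ cong (x⁻¹ *_) xy≡xz ⟩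
      x⁻¹ * (x * z)  ≡⟨ lemma z ⟨
      z              ∎
      where
      reassociate : ∀ a b c → (a * b) * c ≡ b * (a * c)
      reassociate = solve 3 (λ a b c → (a :* b) :* c := b :* (a :* c)) refl
      lemma : ∀ w → w ≡ x⁻¹ * (x * w)
      lemma w = trans (sym (*-identityˡ w)) (trans (cong (_* w) (sym xx⁻¹≡1)) (reassociate x x⁻¹ w))

    *-nonzero : ∀ {x y} → x ≢ 0# → y ≢ 0# → x * y ≢ 0#
    *-nonzero {x} {y} x≢0 y≢0 xy≡0 = y≢0 (*-cancelˡ y 0# x≢0 (trans xy≡0 (sym (zeroʳ x))))

    nonzeroˡ : ∀ {x y} → x * y ≢ 0# → x ≢ 0#
    nonzeroˡ {x} {y} xy≢0 x≡0 = xy≢0 (trans (cong (_* y) x≡0) (zeroˡ y))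

    nonzeroʳ : ∀ {x y} → x * y ≢ 0# → y ≢ 0#
    nonzeroʳ {x} {y} xy≢0 y≡0 = xy≢0 (trans (cong (x *_) y≡0) (zeroʳ x))

    ^-nonzero : ∀ {x} n → x ≢ 0# → x ^ n ≢ 0#
    ^-nonzero zero    x≢0 = 1≢0
    ^-nonzero (suc n) x≢0 = *-nonzero x≢0 (^-nonzero n x≢0)

    0^ : ∀ {n} → 1 ≤ n → 0# ^ n ≡ 0#
    0^ {suc n} _ = zeroˡ (0# ^ n)

    1^ : ∀ n → 1# ^ n ≡ 1#
    1^ zero    = refl
    1^ (suc n) = trans (*-identityˡ _) (1^ n)

    ^-nonzero⁻¹ : ∀ {x n} → 1 ≤ n → x ^ n ≢ 0# → x ≢ 0#
    ^-nonzero⁻¹ 1≤n xⁿ≢0 refl = xⁿ≢0 (0^ 1≤n)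

    ^≡1⇒≢0 : ∀ {x n} → 1 ≤ n → x ^ n ≡ 1# → x ≢ 0#
    ^≡1⇒≢0 1≤n xⁿ≡1 = ^-nonzero⁻¹ 1≤n (λ xⁿ≡0 → 1≢0 (trans (sym xⁿ≡1) xⁿ≡0))

    quotient : ∀ x {y} → y ≢ 0# → ∃[ z ] x ≡ y * z
    quotient x {y} y≢0 with inverse y y≢0
    ... | y⁻¹ , yy⁻¹≡1 = y⁻¹ * x , (begin
      x              ≡⟨ *-identityˡ x ⟨
      1# * x         ≡⟨ cong (_* x) yy⁻¹≡1 ⟨
      y * y⁻¹ * x    ≡⟨ *-assoc y y⁻¹ x ⟩
      y * (y⁻¹ * x)  ∎)

    quotient-^ : ∀ {x y z} n → y ≢ 0# → x ≡ y * z → x ^ n ≡ y ^ n → z ^ n ≡ 1#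
    quotient-^ {x} {y} {z} n y≢0 x≡yz xⁿ≡yⁿ = *-cancelˡ _ _ (^-nonzero n y≢0) (begin
      y ^ n * z ^ n  ≡⟨ ^-distrib-* y z n ⟨
      (y * z) ^ n    ≡⟨ cong (_^ n) x≡yz ⟨
      x ^ n          ≡⟨ xⁿ≡yⁿ ⟩
      y ^ n          ≡⟨ *-identityʳ _ ⟨
      y ^ n * 1#     ∎)

    translation : K → Permutation (suc r) (suc r)
    translation c = permutation (_+ c) (_+ - c) right left
      where
      left : ∀ x → x + c + - c ≡ x
      left x = trans (+-assoc x c (- c)) (trans (cong (x +_) (-‿inverseʳ c)) (+-identityʳ x))
      right : ∀ x → x + - c + c ≡ x
      right x = trans (+-assoc x (- c) c) (trans (cong (x +_) (-‿inverseˡ c)) (+-identityʳ x))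

    dilation : ∀ {c} → c ≢ 0# → Permutation (suc r) (suc r)
    dilation {c} c≢0 with inverse c c≢0
    ... | c⁻¹ , cc⁻¹≡1 = permutation (c *_) (c⁻¹ *_) right left
      where
      right : ∀ x → c * (c⁻¹ * x) ≡ x
      right x = trans (sym (*-assoc c c⁻¹ x)) (trans (cong (_* x) cc⁻¹≡1) (*-identityˡ x))
      left : ∀ x → c⁻¹ * (c * x) ≡ x
      left x = trans (sym (*-assoc c⁻¹ c x))
        (trans (cong (_* x) (trans (*-comm c⁻¹ c) cc⁻¹≡1)) (*-identityˡ x))

    -- Multiplication by a permutes the nonzero elements, so it does not change their product.
    fermat : ∀ {a} → a ≢ 0# → a ^ r ≡ 1#
    fermat {a} a≢0 = trans (sym ∏c≡aʳ) (*-cancelˡ _ _ ∏g≢0 (begin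
      ∏.sum g * ∏.sum c          ≡⟨ *-comm (∏.sum g) (∏.sum c) ⟩
      ∏.sum c * ∏.sum g          ≡⟨ ∏.∑-distrib-+ c g ⟨
      ∏.sum (λ x → c x * g x)    ≡⟨ ∏.sum-cong-≗ g[ax] ⟨
      ∏.sum (λ x → g (a * x))    ≡⟨ permuted ⟨
      ∏.sum g                    ≡⟨ *-identityʳ _ ⟨
      ∏.sum g * 1#               ∎))
      where
      c g : K → K
      c x with x Fin.≟ 0#
      ... | yes _ = 1#
      ... | no  _ = a
      g x with x Fin.≟ 0#
      ... | yes _ = 1#
      ... | no  _ = x
      g[ax] : ∀ x → g (a * x) ≡ c x * g x
      g[ax] x with x Fin.≟ 0# | (a * x) Fin.≟ 0#
      ... | yes _   | yes _    = sym (*-identityˡ 1#)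
      ... | yes x≡0 | no ax≢0  = contradiction (trans (cong (a *_) x≡0) (zeroʳ a)) ax≢0
      ... | no x≢0  | yes ax≡0 = contradiction ax≡0 (*-nonzero a≢0 x≢0)
      ... | no _    | no _     = refl
      permuted : ∏.sum g ≡ ∏.sum (λ x → g (a * x))
      permuted with inverse a a≢0 | ∏.sum-permute g (dilation a≢0)
      ... | _ | eq = eq
      g≢0 : ∀ x → g x ≢ 0#
      g≢0 x with x Fin.≟ 0#
      ... | yes _  = 1≢0
      ... | no x≢0 = x≢0
      product≢0 : ∀ {n} (h : Fin n → K) → (∀ i → h i ≢ 0#) → ∏.sum h ≢ 0#
      product≢0 {zero}  h h≢0 = 1≢0
      product≢0 {suc n} h h≢0 = *-nonzero (h≢0 Fin.zero) (product≢0 (h ∘ Fin.suc) (h≢0 ∘ Fin.suc))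
      ∏g≢0 : ∏.sum g ≢ 0#
      ∏g≢0 = product≢0 g g≢0
      c0 : c 0# ≡ 1#
      c0 with 0# Fin.≟ 0#
      ... | yes _  = refl
      ... | no 0≢0 = contradiction refl 0≢0
      c-punchIn : ∀ i → c (punchIn 0# i) ≡ a
      c-punchIn i with punchIn 0# i Fin.≟ 0#
      ... | yes eq = contradiction eq (Fin.punchInᵢ≢i 0# i)
      ... | no _   = refl
      ∏c≡aʳ : ∏.sum c ≡ a ^ r
      ∏c≡aʳ = begin
        ∏.sum c                                ≡⟨ ∏.sum-remove {i = 0#} c ⟩
        c 0# * ∏.sum (λ i → c (punchIn 0# i))  ≡⟨ cong₂ _*_ c0 (∏.sum-cong-≗ c-punchIn) ⟩
        1# * ∏.sum {r} (λ _ → a)               ≡⟨ *-identityˡ _ ⟩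
        ∏.sum {r} (λ _ → a)                    ≡⟨ ∏.sum-replicate r ⟩
        a ^ r                                  ∎

    -- Monic polynomials: cs stands for c₀ + c₁ x + … + xⁿ with n = length cs.
    eval : List K → K → K
    eval []       x = 1#
    eval (c ∷ cs) x = c + x * eval cs x

    -- Synthetic division: the quotient of `c ∷ cs` by x - a is `deflate a cs`, whose coefficients
    -- are the intermediate values of Horner's scheme at a.
    deflate : K → List K → List K
    deflate a []       = []
    deflate a (c ∷ cs) = eval (c ∷ cs) a ∷ deflate a cs

    length-deflate : ∀ a cs → length (deflate a cs) ≡ length cs
    length-deflate a []       = refl
    length-deflate a (c ∷ cs) = cong suc (length-deflate a cs)

    -- p(x) − p(a) = (x − a) · deflate(x), without subtraction.
    eval-deflate : ∀ a c cs x →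
      eval (c ∷ cs) x + a * eval (deflate a cs) x ≡ eval (c ∷ cs) a + x * eval (deflate a cs) x
    eval-deflate a c []        x = swap a c x 1#
      where
      swap : ∀ a c x u → c + x * u + a * u ≡ c + a * u + x * u
      swap = solve 4 (λ a c x u → c :+ x :* u :+ a :* u := c :+ a :* u :+ x :* u) refl
    eval-deflate a c (c′ ∷ cs) x = begin
      c + x * P x + a * (P a + x * Q)    ≡⟨ left a c x (P x) (P a) Q ⟩
      c + a * P a + x * (P x + a * Q)    ≡⟨ cong (λ y → c + a * P a + x * y) (eval-deflate a c′ cs x) ⟩
      c + a * P a + x * (P a + x * Q)    ∎
      where
      P = eval (c′ ∷ cs)
      Q = eval (deflate a cs) x
      left : ∀ a c x px pa q → c + x * px + a * (pa + x * q) ≡ c + a * pa + x * (px + a * q)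
      left = solve 6 (λ a c x px pa q → c :+ x :* px :+ a :* (pa :+ x :* q) := c :+ a :* pa :+ x :* (px :+ a :* q)) refl

    deflate-root : ∀ {a c cs x} → x ≢ a → eval (c ∷ cs) a ≡ 0# → eval (c ∷ cs) x ≡ 0# →
                   eval (deflate a cs) x ≡ 0#
    deflate-root {a} {c} {cs} {x} x≢a pa≡0 px≡0 with eval (deflate a cs) x Fin.≟ 0#
    ... | yes eq = eq
    ... | no Q≢0 = contradiction (sym (*-cancelˡ _ _ Q≢0 (begin
      Q * a                  ≡⟨ *-comm Q a ⟩
      a * Q                  ≡⟨ +-identityˡ _ ⟨
      0# + a * Q             ≡⟨ cong (_+ a * Q) px≡0 ⟨
      eval (c ∷ cs) x + a * Q  ≡⟨ eval-deflate a c cs x ⟩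
      eval (c ∷ cs) a + x * Q  ≡⟨ cong (_+ x * Q) pa≡0 ⟩
      0# + x * Q             ≡⟨ +-identityˡ _ ⟩
      x * Q                  ≡⟨ *-comm x Q ⟩
      Q * x                  ∎))) x≢a
      where Q = eval (deflate a cs) x

    -- Splitting off one root by `deflate` keeps the other roots. Since all polynomials are monic,
    -- degree 0 means the constant 1, which has no root.
    roots-bound : ∀ cs xs → Unique xs → All (λ x → eval cs x ≡ 0#) xs → length xs ≤ length cs
    roots-bound cs       []       _            _              = z≤n
    roots-bound []       (x ∷ xs) _            (1≡0 ∷ _)      = contradiction 1≡0 1≢0
    roots-bound (c ∷ cs) (x ∷ xs) (x∉xs ∷ uxs) (px≡0 ∷ pxs≡0) =
      s≤s (subst (length xs ≤_) (length-deflate x cs)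
        (roots-bound (deflate x cs) xs uxs
          (All.zipWith (λ (x≢y , py≡0) → deflate-root {cs = cs} (x≢y ∘ sym) px≡0 py≡0) (x∉xs , pxs≡0))))

    eval-power : ∀ n x → eval (replicate n 0#) x ≡ x ^ n
    eval-power zero    x = refl
    eval-power (suc n) x = trans (+-identityˡ _) (cong (x *_) (eval-power n x))

    powers-bound : ∀ {n a} xs → 1 ≤ n → Unique xs → All (λ x → x ^ n ≡ a) xs → length xs ≤ n
    powers-bound {suc n} {a} xs _ uxs all =
      subst (length xs ≤_) (cong suc (List.length-replicate n))
        (roots-bound (- a ∷ replicate n 0#) xs uxs (All.map root all))
      where
      root : ∀ {x} → x ^ suc n ≡ a → eval (- a ∷ replicate n 0#) x ≡ 0#
      root {x} eq = trans (cong (λ y → - a + x * y) (eval-power n x))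
        (trans (cong (- a +_) eq) (-‿inverseˡ a))

    record HasOrder (k : ℕ) (u : K) : Set where
      field
        positive : 1 ≤ k
        ^k≡1     : u ^ k ≡ 1#
        minimal  : ∀ {i} → 1 ≤ i → i < k → u ^ i ≢ 1#

    module _ {k : ℕ} {u : K} (o : HasOrder k u) where
      open HasOrder o

      private
        u≢0 : u ≢ 0#
        u≢0 = ^≡1⇒≢0 positive ^k≡1

        powers-distinct : ∀ {i j} → i < j → j < k → u ^ i ≢ u ^ j
        powers-distinct {i} {j} i<j j<k eq = minimal (ℕ.m<n⇒0<n∸m i<j) (ℕ.≤-<-trans (ℕ.m∸n≤m j i) j<k)
          (*-cancelˡ _ _ (^-nonzero i u≢0) (begin
            u ^ i * u ^ (j ∸ i)  ≡⟨ ^-homo-* u i (j ∸ i) ⟨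
            u ^ (i ℕ.+ (j ∸ i))  ≡⟨ cong (u ^_) (ℕ.m+[n∸m]≡n (ℕ.<⇒≤ i<j)) ⟩
            u ^ j                ≡⟨ eq ⟨
            u ^ i                ≡⟨ *-identityʳ _ ⟨
            u ^ i * 1#           ∎))

      ^-injective : ∀ (i j : Fin k) → u ^ toℕ i ≡ u ^ toℕ j → i ≡ j
      ^-injective i j eq with ℕ.<-cmp (toℕ i) (toℕ j)
      ... | tri< i<j _ _ = contradiction eq (powers-distinct i<j (Fin.toℕ<n j))
      ... | tri≈ _ i≡j _ = Fin.toℕ-injective i≡j
      ... | tri> _ _ j<i = contradiction (sym eq) (powers-distinct j<i (Fin.toℕ<n i))

      -- The k powers of u are already k distinct roots of zᵏ = 1; a further root would exceed the
      -- degree.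
      roots-of-unity : ∀ {z} → z ^ k ≡ 1# → ∃[ i ] z ≡ u ^ toℕ {k} i
      roots-of-unity {z} zᵏ≡1 with Fin.any? (λ i → z Fin.≟ u ^ toℕ i)
      ... | yes found = found
      ... | no ¬found = contradiction
        (powers-bound (z ∷ tabulate pw) positive
          (All.tabulate⁺ (λ i eq → ¬found (i , eq)) ∷ Unique.tabulate⁺ (λ {i} {j} → ^-injective i j))
          (zᵏ≡1 ∷ All.tabulate⁺ pw^k))
        (ℕ.<⇒≱ (s≤s (ℕ.≤-reflexive (sym (List.length-tabulate pw)))))
        where
        pw : Fin k → K
        pw i = u ^ toℕ i
        pw^k : ∀ i → pw i ^ k ≡ 1#
        pw^k i = begin
          (u ^ toℕ i) ^ k      ≡⟨ ^-assocʳ u (toℕ i) k ⟩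
          u ^ (toℕ i ℕ.* k)    ≡⟨ cong (u ^_) (ℕ.*-comm (toℕ i) k) ⟩
          u ^ (k ℕ.* toℕ i)    ≡⟨ ^-assocʳ u k (toℕ i) ⟨
          (u ^ k) ^ toℕ i      ≡⟨ cong (_^ toℕ i) ^k≡1 ⟩
          1# ^ toℕ i           ≡⟨ 1^ (toℕ i) ⟩
          1#                   ∎

    module _ (d : ℕ) where

      -- Membership in sA. Letting both y and z range over the finite field makes it decidable by
      -- recursion on s.
      SumOfPowers : ℕ → K → Set
      SumOfPowers zero    x = x ≡ 0#
      SumOfPowers (suc s) x = ∃[ y ] ∃[ z ] SumOfPowers s z × x ≡ y ^ d + z

      opaque
        sumOfPowers? : ∀ s x → Dec (SumOfPowers s x)
        sumOfPowers? zero    x = x Fin.≟ 0#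
        sumOfPowers? (suc s) x =
          Fin.any? (λ y → Fin.any? (λ z → sumOfPowers? s z ×-dec (x Fin.≟ y ^ d + z)))

      sumOfPowers-+ : ∀ {s t x y} → SumOfPowers s x → SumOfPowers t y → SumOfPowers (s ℕ.+ t) (x + y)
      sumOfPowers-+ {zero}  {y = y} refl q = subst (SumOfPowers _) (sym (+-identityˡ y)) q
      sumOfPowers-+ {suc s} {y = y} (a , b , p , refl) q = a , b + y , sumOfPowers-+ {s} p q , +-assoc (a ^ d) b y

      sumOfPowers-* : ∀ {s x} c → SumOfPowers s x → SumOfPowers s (c ^ d * x)
      sumOfPowers-* {zero}  c refl = zeroʳ (c ^ d)
      sumOfPowers-* {suc s} c (a , b , p , refl) = c * a , c ^ d * b , sumOfPowers-* {s} c p ,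
        trans (distribˡ (c ^ d) (a ^ d) b) (cong (_+ c ^ d * b) (sym (^-distrib-* c a d)))

      power-isSum : ∀ c → SumOfPowers 1 (c ^ d)
      power-isSum c = c , 0# , refl , sym (+-identityʳ _)

      module _ (1≤d : 1 ≤ d) where

        sumOfPowers-0 : ∀ s → SumOfPowers s 0#
        sumOfPowers-0 zero    = refl
        sumOfPowers-0 (suc s) = 0# , 0# , sumOfPowers-0 s , sym (trans (+-identityʳ _) (0^ 1≤d))

        sumOfPowers-≤ : ∀ {s t x} → s ≤ t → SumOfPowers s x → SumOfPowers t x
        sumOfPowers-≤ {t = t} z≤n refl = sumOfPowers-0 t
        sumOfPowers-≤ (s≤s s≤t) (a , b , p , eq) = a , b , sumOfPowers-≤ s≤t p , eq

-- Second moments of correlations over all dilations.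

module EnergyMethod where
  open import Data.Fin.Base as Fin using (Fin; punchIn)
  open import Data.Fin.Permutation using (permutation)
  import Data.Fin.Properties as Fin
  open import Data.Integer.Base as ℤ using (ℤ; 0ℤ; _+_; _*_; _-_; -_; _≤_; +≤+) renaming (+_ to pos)
  import Data.Integer.Properties as ℤ
  open import Data.Integer.Tactic.RingSolver using (solve-∀)
  open import Data.Nat.Base as ℕ using (ℕ; suc)
  import Data.Nat.Properties as ℕ
  open import Data.Product.Base using (_,_)
  open import Function.Base using (_∘_)
  open import Relation.Binary.PropositionalEquality
  open Fields
  open IntegerSums

  module Variance {r : ℕ} (F : FieldOn (Fin (suc r))) where
    open FiniteFieldTheory F
      renaming (_+_ to _⊕_; _*_ to _⊛_; -_ to ⊝_)

    q : ℤ
    q = pos (suc r)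

    correlation : (f g : K → ℤ) → K → K → ℤ
    correlation f g m t = sum (λ v → g v * f (t ⊕ m ⊛ v))

    energy : (f g : K → ℤ) → K → ℤ
    energy f g m = sum (λ t → correlation f g m t * correlation f g m t)

    norm² : (K → ℤ) → ℤ
    norm² f = sum (λ x → f x * f x)

    sum-translate : ∀ (f : K → ℤ) c → sum (λ x → f (x ⊕ c)) ≡ sum f
    sum-translate f c = sym (sum-permute f (translation c))

    sum-dilate : ∀ (f : K → ℤ) {c} → c ≢ 0# → sum (λ x → f (c ⊛ x)) ≡ sum f
    -- `dilation` matches on the inverse of c; abstracting this inverse as well lets the permutation
    -- compute to multiplication by c.
    sum-dilate f {c} c≢0 with inverse c c≢0 | sum-permute f (dilation c≢0)
    ... | _ | eq = sym eq

    sum-negate : ∀ (f : K → ℤ) → sum (λ x → f (⊝ x)) ≡ sum f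
    sum-negate f = sym (sum-permute f (permutation ⊝_ ⊝_ -‿involutive -‿involutive))

    -- The coefficient of g(v) g(w) in the expansion of the total energy.
    coincidence : (f : K → ℤ) → K → K → ℤ
    coincidence f v w = sum (λ m → sum (λ t → f (t ⊕ m ⊛ v) * f (t ⊕ m ⊛ w)))

    coincidence-diagonal : ∀ f v → coincidence f v v ≡ q * norm² f
    coincidence-diagonal f v =
      trans (sum-cong (λ m → sum-translate (λ x → f x * f x) (m ⊛ v))) (sum-const (suc r) (norm² f))

    -- For v ≠ w the map (m , t) ↦ (t + mv , t + mw) is a bijection.
    coincidence-off-diagonal : ∀ f {v w} → v ≢ w → sum f ≡ 0ℤ → coincidence f v w ≡ 0ℤ
    coincidence-off-diagonal f {v} {w} v≢w ∑f≡0 = begin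
      coincidence f v w
        ≡⟨ sum-cong (λ m → sum-translate (λ t → f (t ⊕ m ⊛ v) * f (t ⊕ m ⊛ w)) (⊝ (m ⊛ v))) ⟨
      sum (λ m → sum (λ t → f (t ⊕ ⊝ (m ⊛ v) ⊕ m ⊛ v) * f (t ⊕ ⊝ (m ⊛ v) ⊕ m ⊛ w)))
        ≡⟨ sum-cong₂ (λ m t → cong₂ (λ x y → f x * f y) (cancel t (m ⊛ v)) (shear m t)) ⟩
      sum (λ m → sum (λ t → f t * f (c ⊛ m ⊕ t)))
        ≡⟨ sum-swap _ ⟩
      sum (λ t → sum (λ m → f t * f (c ⊛ m ⊕ t)))
        ≡⟨ sum-cong (λ t → sum-*ˡ (f t) (λ m → f (c ⊛ m ⊕ t))) ⟩
      sum (λ t → f t * sum (λ m → f (c ⊛ m ⊕ t)))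
        ≡⟨ sum-cong (λ t → cong (f t *_) (vanish t)) ⟩
      sum {suc r} (λ t → f t * 0ℤ)
        ≡⟨ sum-cong (λ t → ℤ.*-zeroʳ (f t)) ⟩
      sum {suc r} (λ t → 0ℤ)
        ≡⟨ sum-0 (suc r) ⟩
      0ℤ ∎
      where
      open ≡-Reasoning
      c = w ⊕ ⊝ v
      c≢0 : c ≢ 0#
      c≢0 c≡0 = v≢w (sym (+-cancelʳ (⊝ v) w v (trans c≡0 (sym (-‿inverseʳ v)))))
      cancel : ∀ t x → t ⊕ ⊝ x ⊕ x ≡ t
      cancel t x = trans (+-assoc t (⊝ x) x) (trans (cong (t ⊕_) (-‿inverseˡ x)) (+-identityʳ t))
      shear : ∀ m t → t ⊕ ⊝ (m ⊛ v) ⊕ m ⊛ w ≡ c ⊛ m ⊕ t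
      shear m t = trans (cong (λ x → t ⊕ x ⊕ m ⊛ w) (-‿distribʳ-* m v))
        (solve 4 (λ t m v′ w → t :+ m :* v′ :+ m :* w := (w :+ v′) :* m :+ t) refl t m (⊝ v) w)
      vanish : ∀ t → sum (λ m → f (c ⊛ m ⊕ t)) ≡ 0ℤ
      vanish t = trans (sum-dilate (λ x → f (x ⊕ t)) c≢0) (trans (sum-translate f t) ∑f≡0)

    -- The total energy is a quadratic form in g with coefficients `coincidence f v w`. As f has sum
    -- 0, only its diagonal survives.
    total-energy : ∀ f g → sum f ≡ 0ℤ → sum (energy f g) ≡ q * (norm² g * norm² f)
    total-energy f g ∑f≡0 = begin
      sum (λ m → sum (λ t → correlation f g m t * correlation f g m t))
        ≡⟨ sum-cong₂ (λ m t → square m t) ⟩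
      sum (λ m → sum (λ t → sum (λ v → sum (λ w → X m t v w))))
        ≡⟨ sum-cong (λ m → sum-swap (λ t v → sum (λ w → X m t v w))) ⟩
      sum (λ m → sum (λ v → sum (λ t → sum (λ w → X m t v w))))
        ≡⟨ sum-swap (λ m v → sum (λ t → sum (λ w → X m t v w))) ⟩
      sum (λ v → sum (λ m → sum (λ t → sum (λ w → X m t v w))))
        ≡⟨ sum-cong₂ (λ v m → sum-swap (λ t w → X m t v w)) ⟩
      sum (λ v → sum (λ m → sum (λ w → sum (λ t → X m t v w))))
        ≡⟨ sum-cong (λ v → sum-swap (λ m w → sum (λ t → X m t v w))) ⟩
      sum (λ v → sum (λ w → sum (λ m → sum (λ t → X m t v w))))
        ≡⟨ sum-cong₂ (λ v w → trans (sum-cong (λ m → sum-*ˡ (g v * g w) _)) (sum-*ˡ (g v * g w) _)) ⟩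
      sum (λ v → sum (λ w → g v * g w * coincidence f v w))
        ≡⟨ sum-cong (λ v → sum-single (λ w → g v * g w * coincidence f v w) v (off v)) ⟩
      sum (λ v → g v * g v * coincidence f v v)
        ≡⟨ sum-cong (λ v → cong (g v * g v *_) (coincidence-diagonal f v)) ⟩
      sum (λ v → g v * g v * (q * norm² f))
        ≡⟨ sum-*ʳ (λ v → g v * g v) (q * norm² f) ⟩
      norm² g * (q * norm² f)
        ≡⟨ rearrange (norm² g) q (norm² f) ⟩
      q * (norm² g * norm² f) ∎
      where
      open ≡-Reasoning
      X : K → K → K → K → ℤ
      X m t v w = g v * g w * (f (t ⊕ m ⊛ v) * f (t ⊕ m ⊛ w))
      rearrange : ∀ a b c → a * (b * c) ≡ b * (a * c)
      rearrange = solve-∀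
      interchange : ∀ a b c d → a * b * (c * d) ≡ a * c * (b * d)
      interchange = solve-∀
      square : ∀ m t → correlation f g m t * correlation f g m t ≡ sum (λ v → sum (λ w → X m t v w))
      square m t = begin
        N * N                              ≡⟨ sum-*ʳ (λ v → g v * f (t ⊕ m ⊛ v)) N ⟨
        sum (λ v → g v * f (t ⊕ m ⊛ v) * N) ≡⟨ sum-cong (λ v → sum-*ˡ (g v * f (t ⊕ m ⊛ v)) _) ⟨
        sum (λ v → sum (λ w → g v * f (t ⊕ m ⊛ v) * (g w * f (t ⊕ m ⊛ w))))
          ≡⟨ sum-cong₂ (λ v w → interchange (g v) (f (t ⊕ m ⊛ v)) (g w) (f (t ⊕ m ⊛ w))) ⟩
        sum (λ v → sum (λ w → X m t v w)) ∎
        where N = correlation f g m t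
      off : ∀ v w → w ≢ v → g v * g w * coincidence f v w ≡ 0ℤ
      off v w w≢v = trans (cong (g v * g w *_) (coincidence-off-diagonal f (w≢v ∘ sym) ∑f≡0)) (ℤ.*-zeroʳ (g v * g w))

    module _ (d : ℕ) (1≤d : 1 ℕ.≤ d) where

      fibre-bound : ∀ m → sum (λ z → 𝟙 (z ^ d Fin.≟ m)) ≤ pos d
      fibre-bound m with count-list (λ z → z ^ d Fin.≟ m)
      ... | xs , unique , roots , eq = subst (_≤ pos d) (trans (cong pos eq) (sym (sum-𝟙 (λ z → z ^ d Fin.≟ m))))
        (+≤+ (powers-bound xs 1≤d unique roots))

      -- Group the z by the value m = zᵈ; each group has at most d members.
      sum-over-powers : ∀ (G : K → ℤ) → (∀ m → 0ℤ ≤ G m) → sum (λ z → G (z ^ d)) ≤ pos d * sum G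
      sum-over-powers G 0≤G = begin
        sum (λ z → G (z ^ d))
          ≡⟨ sum-cong (λ z → sym (trans (sum-single _ (z ^ d) (off z)) (on z))) ⟩
        sum (λ z → sum (λ m → G m * 𝟙 (z ^ d Fin.≟ m)))
          ≡⟨ sum-swap (λ z m → G m * 𝟙 (z ^ d Fin.≟ m)) ⟩
        sum (λ m → sum (λ z → G m * 𝟙 (z ^ d Fin.≟ m)))
          ≡⟨ sum-cong (λ m → sum-*ˡ (G m) (λ z → 𝟙 (z ^ d Fin.≟ m))) ⟩
        sum (λ m → G m * sum (λ z → 𝟙 (z ^ d Fin.≟ m)))
          ≤⟨ sum-mono (λ m → *-monoˡ (0≤G m) (fibre-bound m)) ⟩
        sum (λ m → G m * pos d)
          ≡⟨ sum-*ʳ G (pos d) ⟩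
        sum G * pos d
          ≡⟨ ℤ.*-comm (sum G) (pos d) ⟩
        pos d * sum G ∎
        where
        open ℤ.≤-Reasoning
        off : ∀ z m → m ≢ z ^ d → G m * 𝟙 (z ^ d Fin.≟ m) ≡ 0ℤ
        off z m m≢ = trans (cong (G m *_) (𝟙-no (z ^ d Fin.≟ m) (m≢ ∘ sym))) (ℤ.*-zeroʳ (G m))
        on : ∀ z → G (z ^ d) * 𝟙 (z ^ d Fin.≟ z ^ d) ≡ G (z ^ d)
        on z = trans (cong (G (z ^ d) *_) (𝟙-yes (z ^ d Fin.≟ z ^ d) refl)) (ℤ.*-identityʳ (G (z ^ d)))

      -- Used twice: with G the energy, to bound a single dilation by the total, and with G the
      -- indicator of the nonzero powers, to bound |A| from below.
      sum-over-nonzero-powers : ∀ (G : K → ℤ) c → (∀ m → 0ℤ ≤ G m) → (∀ z → z ≢ 0# → G (z ^ d) ≡ c) →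
                                pos r * c ≤ pos d * sum G
      sum-over-nonzero-powers G c 0≤G const = begin
        pos r * c                                            ≡⟨ sum-const r c ⟨
        sum {r} (λ _ → c)                                    ≡⟨ sum-cong (λ i → const _ (Fin.punchInᵢ≢i 0# i)) ⟨
        sum (λ i → G (punchIn 0# i ^ d))                     ≡⟨ ℤ.+-identityˡ _ ⟨
        0ℤ + sum (λ i → G (punchIn 0# i ^ d))                ≤⟨ ℤ.+-monoˡ-≤ _ (0≤G (0# ^ d)) ⟩
        G (0# ^ d) + sum (λ i → G (punchIn 0# i ^ d))        ≡⟨ sum-remove (λ z → G (z ^ d)) 0# ⟨
        sum (λ z → G (z ^ d))                                ≤⟨ sum-over-powers G 0≤G ⟩
        pos d * sum G                                        ∎
        where open ℤ.≤-Reasoning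

      -- Substituting zᵈv for v leaves g unchanged and moves the dilation from 1 to zᵈ. So the
      -- energy at 1 recurs at every nonzero d-th power and cannot exceed its share of the total.
      energy-bound : ∀ f g → sum f ≡ 0ℤ → (∀ z v → z ≢ 0# → g (z ^ d ⊛ v) ≡ g v) →
                     pos r * energy f g 1# ≤ pos d * (q * (norm² g * norm² f))
      energy-bound f g ∑f≡0 invariant =
        subst (λ e → pos r * energy f g 1# ≤ pos d * e) (total-energy f g ∑f≡0)
          (sum-over-nonzero-powers (energy f g) (energy f g 1#)
            (λ m → sum-nonneg (λ t → square-nonneg (correlation f g m t)))
            (λ z z≢0 → sum-cong (λ t → cong (λ c → c * c) (sym (same z z≢0 t)))))
        where
        open ≡-Reasoning
        same : ∀ z → z ≢ 0# → ∀ t → correlation f g 1# t ≡ correlation f g (z ^ d) t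
        same z z≢0 t = begin
          sum (λ v → g v * f (t ⊕ 1# ⊛ v))
            ≡⟨ sum-dilate (λ v → g v * f (t ⊕ 1# ⊛ v)) (^-nonzero d z≢0) ⟨
          sum (λ v → g (z ^ d ⊛ v) * f (t ⊕ 1# ⊛ (z ^ d ⊛ v)))
            ≡⟨ sum-cong (λ v → cong₂ _*_ (invariant z v z≢0) (cong (λ x → f (t ⊕ x)) (*-identityˡ _))) ⟩
          sum (λ v → g v * f (t ⊕ z ^ d ⊛ v)) ∎

-- Growth of sumsets from the energy bound.

module SumsetGrowth where
  open import Data.Fin.Base using (Fin)
  import Data.Fin.Properties as Fin
  open import Data.Integer.Base as ℤ using (ℤ; 0ℤ; 1ℤ; _+_; _*_; _-_; -_; _≤_; +≤+; +<+) renaming (+_ to pos)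
  import Data.Integer.Properties as ℤ
  open import Data.Integer.Tactic.RingSolver using (solve-∀)
  open import Data.Nat.Base as ℕ using (ℕ; suc; z≤n; s≤s)
  import Data.Nat.Properties as ℕ
  open import Data.Product.Base using (_,_)
  open import Relation.Binary.PropositionalEquality
  open import Relation.Nullary using (yes; no; contradiction)
  open import Relation.Unary using (Pred; Decidable)
  open Fields
  open IntegerSums
  open EnergyMethod

  module Sumset {r : ℕ} (F : FieldOn (Fin (suc r))) (d : ℕ) (1≤d : 1 ℕ.≤ d) where
    open FiniteFieldTheory F
      renaming (_+_ to _⊕_; _*_ to _⊛_; -_ to ⊝_)
    open Variance F

    -- To be applied with U = sA, V = -A and S = (s + 1)A.
    module _ {p} {U V S : Pred K p} (U? : Decidable U) (V? : Decidable V) (S? : Decidable S)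
             (V-invariant : ∀ z v → z ≢ 0# → V (z ^ d ⊛ v) → V v)
             (V-invariant′ : ∀ z v → z ≢ 0# → V v → V (z ^ d ⊛ v))
             (U-V⊆S : ∀ t v → V v → U (t ⊕ v) → S t)
             (0<U : 1 ℕ.≤ count U?) (0<V : 1 ℕ.≤ count V?) (0<S : 1 ℕ.≤ count S?) where

      private
        u v s f n 𝟏 : K → ℤ
        u x = 𝟙 (U? x)
        v x = 𝟙 (V? x)
        s x = 𝟙 (S? x)
        𝟏 _ = 1ℤ
        a b c W E Σn² : ℤ
        a = pos (count U?)
        b = pos (count V?)
        c = pos (count S?)
        W = b * a
        -- The centred indicator of U, multiplied by q to stay within ℤ.
        f x = q * u x - a * 𝟏 x
        -- The number of ways to write t as a difference of an element of U and an element of V. The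
        -- factor 1 keeps the form of `correlation`.
        n t = sum (λ w → v w * u (t ⊕ 1# ⊛ w))
        E = energy f v 1#
        Σn² = sum (λ t → n t * n t)

        idem : ∀ {P : Pred K p} (P? : Decidable P) → norm² (λ x → 𝟙 (P? x)) ≡ pos (count P?)
        idem P? = trans (sum-cong (λ x → 𝟙-idem (P? x))) (sum-𝟙 P?)

        ∑𝟏 : norm² 𝟏 ≡ q
        ∑𝟏 = trans (sum-const (suc r) _) (ℤ.*-identityʳ q)

        ∑1 : sum 𝟏 ≡ q
        ∑1 = trans (sum-const (suc r) _) (ℤ.*-identityʳ q)

        ∑x1 : ∀ (x : K → ℤ) → sum (λ i → x i * 𝟏 i) ≡ sum x
        ∑x1 x = sum-cong (λ i → ℤ.*-identityʳ (x i))

        ∑f≡0 : sum f ≡ 0ℤ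
        ∑f≡0 = begin
          sum f                  ≡⟨ sum-linear q a u 𝟏 ⟩
          q * sum u - a * sum 𝟏  ≡⟨ cong₂ (λ x y → q * x - a * y) (sum-𝟙 U?) ∑1 ⟩
          q * a - a * q          ≡⟨ zero-sum q a ⟩
          0ℤ                     ∎
          where
          open ≡-Reasoning
          zero-sum : ∀ q a → q * a - a * q ≡ 0ℤ
          zero-sum = solve-∀

        norm²f : norm² f ≡ q * (a * (q - a))
        norm²f = begin
          norm² f
            ≡⟨ sum-quadratic q a u 𝟏 ⟩
          q * q * norm² u - pos 2 * (q * a) * sum (λ x → u x * 𝟏 x) + a * a * norm² 𝟏
            ≡⟨ cong₂ _+_ (cong₂ (λ x y → q * q * x - pos 2 * (q * a) * y) (idem U?) (trans (∑x1 u) (sum-𝟙 U?)))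
                         (cong (a * a *_) ∑𝟏) ⟩
          q * q * a - pos 2 * (q * a) * a + a * a * q
            ≡⟨ factor q a ⟩
          q * (a * (q - a)) ∎
          where
          open ≡-Reasoning
          factor : ∀ q a → q * q * a - pos 2 * (q * a) * a + a * a * q ≡ q * (a * (q - a))
          factor = solve-∀

        ∑n : sum n ≡ W
        ∑n = begin
          sum (λ t → sum (λ w → v w * u (t ⊕ 1# ⊛ w)))  ≡⟨ sum-swap (λ t w → v w * u (t ⊕ 1# ⊛ w)) ⟩
          sum (λ w → sum (λ t → v w * u (t ⊕ 1# ⊛ w)))  ≡⟨ sum-cong (λ w → sum-*ˡ (v w) (λ t → u (t ⊕ 1# ⊛ w))) ⟩
          sum (λ w → v w * sum (λ t → u (t ⊕ 1# ⊛ w)))  ≡⟨ sum-cong (λ w → cong (v w *_) (trans (sum-translate u (1# ⊛ w)) (sum-𝟙 U?))) ⟩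
          sum (λ w → v w * a)                           ≡⟨ sum-*ʳ v a ⟩
          sum v * a                                     ≡⟨ cong (_* a) (sum-𝟙 V?) ⟩
          b * a                                         ∎
          where open ≡-Reasoning

        supported : ∀ t → n t * s t ≡ n t
        supported t with S? t
        ... | yes _ = ℤ.*-identityʳ (n t)
        ... | no ¬s = trans (ℤ.*-zeroʳ (n t)) (sym (trans (sum-cong vanish) (sum-0 (suc r))))
          where
          vanish : ∀ w → v w * u (t ⊕ 1# ⊛ w) ≡ 0ℤ
          vanish w with V? w | U? (t ⊕ 1# ⊛ w)
          ... | no _   | _      = refl
          ... | yes _  | no _   = refl
          ... | yes Vw | yes Uw = contradiction (U-V⊆S t w Vw (subst U (cong (t ⊕_) (*-identityˡ w)) Uw)) ¬s

        -- Since n has sum W and vanishes outside S, the nonnegative sum of (c n - W s)² equals c (c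
        -- Σn² - W²).
        cauchy-schwarz : W * W ≤ c * Σn²
        cauchy-schwarz = *-cancel-≤ (+<+ 0<S) (ℤ.0≤i-j⇒j≤i (subst (0ℤ ≤_) expand
          (sum-nonneg (λ t → square-nonneg (c * n t - W * s t)))))
          where
          open ≡-Reasoning
          collect : ∀ c e W → c * c * e - pos 2 * (c * W) * W + W * W * c ≡ c * (c * e) - c * (W * W)
          collect = solve-∀
          expand : sum (λ t → (c * n t - W * s t) * (c * n t - W * s t)) ≡ c * (c * Σn²) - c * (W * W)
          expand = begin
            sum (λ t → (c * n t - W * s t) * (c * n t - W * s t))
              ≡⟨ sum-quadratic c W n s ⟩
            c * c * Σn² - pos 2 * (c * W) * sum (λ t → n t * s t) + W * W * norm² s
              ≡⟨ cong₂ (λ x y → c * c * Σn² - pos 2 * (c * W) * x + W * W * y)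
                       (trans (sum-cong supported) ∑n) (idem S?) ⟩
            c * c * Σn² - pos 2 * (c * W) * W + W * W * c
              ≡⟨ collect c Σn² W ⟩
            c * (c * Σn²) - c * (W * W) ∎

        correlation≡ : ∀ t → correlation f v 1# t ≡ q * n t - W * 𝟏 t
        correlation≡ t = begin
          sum (λ w → v w * (q * u (t ⊕ 1# ⊛ w) - a * 1ℤ))
            ≡⟨ sum-cong (λ w → distribute (v w) q (u (t ⊕ 1# ⊛ w)) a) ⟩
          sum (λ w → q * (v w * u (t ⊕ 1# ⊛ w)) - a * v w)
            ≡⟨ sum-linear q a (λ w → v w * u (t ⊕ 1# ⊛ w)) v ⟩
          q * n t - a * sum v
            ≡⟨ cong (λ x → q * n t - a * x) (sum-𝟙 V?) ⟩
          q * n t - a * b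
            ≡⟨ cong (λ x → q * n t - x) (trans (ℤ.*-comm a b) (sym (ℤ.*-identityʳ W))) ⟩
          q * n t - W * 1ℤ ∎
          where
          open ≡-Reasoning
          distribute : ∀ v q u a → v * (q * u - a * 1ℤ) ≡ q * (v * u) - a * v
          distribute = solve-∀

        energy≡ : E ≡ q * (q * Σn² - W * W)
        energy≡ = begin
          E ≡⟨ sum-cong (λ t → cong (λ x → x * x) (correlation≡ t)) ⟩
          sum (λ t → (q * n t - W * 𝟏 t) * (q * n t - W * 𝟏 t))
            ≡⟨ sum-quadratic q W n 𝟏 ⟩
          q * q * Σn² - pos 2 * (q * W) * sum (λ t → n t * 𝟏 t) + W * W * norm² 𝟏
            ≡⟨ cong₂ (λ x y → q * q * Σn² - pos 2 * (q * W) * x + W * W * y) (trans (∑x1 n) ∑n) ∑𝟏 ⟩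
          q * q * Σn² - pos 2 * (q * W) * W + W * W * q
            ≡⟨ collect q Σn² W ⟩
          q * (q * Σn² - W * W) ∎
          where
          open ≡-Reasoning
          collect : ∀ q e W → q * q * e - pos 2 * (q * W) * W + W * W * q ≡ q * (q * e - W * W)
          collect = solve-∀

        0≤ : ∀ {i} → 0ℤ ≤ pos i
        0≤ = +≤+ z≤n

        0<qW : 0ℤ ℤ.< q * W
        0<qW = subst (0ℤ ℤ.<_) (trans (ℤ.pos-* (suc r) _) (cong (q *_) (ℤ.pos-* (count V?) (count U?))))
                 (+<+ (ℕ.*-mono-≤ (s≤s (z≤n {r})) (ℕ.*-mono-≤ 0<V 0<U)))

      -- Cauchy-Schwarz bounds the energy at 1 from below: the smaller S is, the more the counts n
      -- are concentrated. `energy-bound` bounds it from above. Comparing the two leaves a common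
      -- factor qW, which is positive.
      sumset-boundᶻ : pos r * (W * (q - c)) ≤ pos d * (q * (c * (q - a)))
      sumset-boundᶻ = *-cancel-≤ 0<qW (begin
        q * W * (pos r * (W * (q - c)))
          ≡⟨ regroup₁ q W (pos r) c ⟩
        pos r * (q * (q * (W * W) - c * (W * W)))
          ≤⟨ *-monoˡ (0≤ {r}) (*-monoˡ (0≤ {suc r}) (ℤ.+-monoˡ-≤ (- (c * (W * W))) (*-monoˡ (0≤ {suc r}) cauchy-schwarz))) ⟩
        pos r * (q * (q * (c * Σn²) - c * (W * W)))
          ≡⟨ regroup₂ (pos r) q c Σn² W ⟩
        c * (pos r * (q * (q * Σn² - W * W)))
          ≡⟨ cong (λ e → c * (pos r * e)) energy≡ ⟨
        c * (pos r * E)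
          ≤⟨ *-monoˡ (0≤ {count S?}) (energy-bound d 1≤d f v ∑f≡0 v-invariant) ⟩
        c * (pos d * (q * (norm² v * norm² f)))
          ≡⟨ cong₂ (λ x y → c * (pos d * (q * (x * y)))) (idem V?) norm²f ⟩
        c * (pos d * (q * (b * (q * (a * (q - a))))))
          ≡⟨ regroup₃ c (pos d) q b a ⟩
        q * W * (pos d * (q * (c * (q - a)))) ∎)
        where
        open ℤ.≤-Reasoning
        regroup₁ : ∀ q W r c → q * W * (r * (W * (q - c))) ≡ r * (q * (q * (W * W) - c * (W * W)))
        regroup₁ = solve-∀
        regroup₂ : ∀ r q c e W → r * (q * (q * (c * e) - c * (W * W))) ≡ c * (r * (q * (q * e - W * W)))
        regroup₂ = solve-∀
        regroup₃ : ∀ c d q b a → c * (d * (q * (b * (q * (a * (q - a)))))) ≡ q * (b * a) * (d * (q * (c * (q - a))))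
        regroup₃ = solve-∀
        v-invariant : ∀ z x → z ≢ 0# → v (z ^ d ⊛ x) ≡ v x
        v-invariant z x z≢0 = 𝟙-cong (V? _) (V? x) (V-invariant z x z≢0) (V-invariant′ z x z≢0)

      -- Complements given by equations keep truncated subtraction out of the estimates that follow.
      sumset-bound : ∀ {a′ c′} → count U? ℕ.+ a′ ≡ suc r → count S? ℕ.+ c′ ≡ suc r →
        r ℕ.* (count V? ℕ.* count U? ℕ.* c′) ℕ.≤ d ℕ.* (suc r ℕ.* (count S? ℕ.* a′))
      sumset-bound {a′} {c′} eqᵃ eqᶜ = ℤ.drop‿+≤+ (subst₂ _≤_ lhs rhs sumset-boundᶻ)
        where
        open ≡-Reasoning
        complement : ∀ {x y} → x ℕ.+ y ≡ suc r → q - pos x ≡ pos y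
        complement {x} {y} eq = begin
          q - pos x              ≡⟨ cong (λ z → pos z - pos x) eq ⟨
          pos (x ℕ.+ y) - pos x  ≡⟨ cong (_- pos x) (ℤ.pos-+ x y) ⟩
          pos x + pos y - pos x  ≡⟨ cancel (pos x) (pos y) ⟩
          pos y                  ∎
          where
          cancel : ∀ x y → x + y - x ≡ y
          cancel = solve-∀
        lhs : pos r * (W * (q - c)) ≡ pos (r ℕ.* (count V? ℕ.* count U? ℕ.* c′))
        lhs = sym (trans (ℤ.pos-* r _) (cong (pos r *_) (trans (ℤ.pos-* (count V? ℕ.* count U?) c′)
                (cong₂ _*_ (ℤ.pos-* (count V?) (count U?)) (sym (complement eqᶜ))))))
        rhs : pos d * (q * (c * (q - a))) ≡ pos (d ℕ.* (suc r ℕ.* (count S? ℕ.* a′)))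
        rhs = sym (trans (ℤ.pos-* d _) (cong (pos d *_) (trans (ℤ.pos-* (suc r) _)
                (cong (q *_) (trans (ℤ.pos-* (count S?) a′) (cong (c *_) (sym (complement eqᵃ))))))))

-- Every element is a sum of six powers when n is large against d.

module SixPowers where
  open import Data.Fin.Base as Fin using (Fin)
  import Data.Fin.Properties as Fin
  open import Data.Integer.Base as ℤ using (ℤ; 0ℤ; 1ℤ; +≤+) renaming (+_ to pos)
  import Data.Integer.Properties as ℤ
  open import Data.Nat.Base as ℕ using (ℕ; zero; suc; z≤n; s≤s; _∸_; _≤_; _<_; _+_; _*_; >-nonZero)
  import Data.Nat.Properties as ℕ
  open import Data.Nat.Tactic.RingSolver using (solve-∀)
  open import Data.Product.Base using (_,_)
  open import Relation.Binary.PropositionalEquality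
  open import Relation.Nullary using (yes; no; contradiction; ¬_)
  open import Relation.Unary using (Decidable)
  open Fields
  open IntegerSums
  open EnergyMethod
  open SumsetGrowth

  -- Here a, s, t stand for |A|, |2A|, |3A|, a prime marks the complement, and the exponent `suc d`
  -- is called d in the proof. Once 3A fills at most half of the field, t and t′ drop out of the
  -- second bound; multiplying it with the first removes s and s′ and leaves r² a³ ≤ d² q² a′. Now
  -- insert a ≥ n + 1, a′ ≤ (d - 1) n and q ≤ d (n + 1).
  no-such-sizes : ∀ {d n a a′ s s′ t t′} → 1 ≤ n → 1 ≤ s → 1 ≤ t → suc n ≤ a → t ≤ t′ →
    a + a′ ≡ suc (suc d * n) →
    suc d * n * (a * a * s′) ≤ suc d * (suc (suc d * n) * (s * a′)) →
    suc d * n * (a * s * t′) ≤ suc d * (suc (suc d * n) * (t * s′)) →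
    n * suc n ≤ suc d * suc d * d
  no-such-sizes {e} {n@(suc _)} {a} {a′} {s} {s′} {t} {t′} _ 1≤s 1≤t n<a t≤t′ a+a′ bound₁ bound₂ =
    ℕ.*-cancelˡ-≤ (d * d * n * suc n * suc n) final
    where
    open ℕ.≤-Reasoning
    d = suc e
    r = d * n
    q = suc r
    cancel-t : r * (a * s) ≤ d * (q * s′)
    cancel-t = ℕ.*-cancelˡ-≤ t {{>-nonZero 1≤t}} (begin
      t * (r * (a * s))    ≡⟨ move₁ t r (a * s) ⟩
      r * (a * s * t)      ≤⟨ ℕ.*-monoʳ-≤ r (ℕ.*-monoʳ-≤ (a * s) t≤t′) ⟩
      r * (a * s * t′)     ≤⟨ bound₂ ⟩
      d * (q * (t * s′))   ≡⟨ move₂ d q t s′ ⟩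
      t * (d * (q * s′))   ∎)
      where
      move₁ : ∀ t r x → t * (r * x) ≡ r * (x * t)
      move₁ = solve-∀
      move₂ : ∀ d q t s → d * (q * (t * s)) ≡ t * (d * (q * s))
      move₂ = solve-∀
    cancel-s : r * r * (a * (a * a)) ≤ d * q * (d * q * a′)
    cancel-s = ℕ.*-cancelˡ-≤ s {{>-nonZero 1≤s}} (begin
      s * (r * r * (a * (a * a)))        ≡⟨ move₁ s r a ⟩
      r * a * a * (r * (a * s))          ≤⟨ ℕ.*-monoʳ-≤ (r * a * a) cancel-t ⟩
      r * a * a * (d * (q * s′))         ≡⟨ move₂ r a d q s′ ⟩
      d * q * (r * (a * a * s′))         ≤⟨ ℕ.*-monoʳ-≤ (d * q) bound₁ ⟩
      d * q * (d * (q * (s * a′)))       ≡⟨ move₃ d q s a′ ⟩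
      s * (d * q * (d * q * a′))         ∎)
      where
      move₁ : ∀ s r a → s * (r * r * (a * (a * a))) ≡ r * a * a * (r * (a * s))
      move₁ = solve-∀
      move₂ : ∀ r a d q s → r * a * a * (d * (q * s)) ≡ d * q * (r * (a * a * s))
      move₂ = solve-∀
      move₃ : ∀ d q s a → d * q * (d * (q * (s * a))) ≡ s * (d * q * (d * q * a))
      move₃ = solve-∀
    a′≤ : a′ ≤ e * n
    a′≤ = ℕ.+-cancelˡ-≤ (suc n) a′ (e * n) (begin
      suc n + a′       ≤⟨ ℕ.+-monoˡ-≤ a′ n<a ⟩
      a + a′           ≡⟨ a+a′ ⟩
      suc n + e * n    ∎)
    q≤ : q ≤ d * suc n
    q≤ = begin
      1 + d * n        ≤⟨ ℕ.+-monoˡ-≤ (d * n) (s≤s (z≤n {e})) ⟩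
      d + d * n        ≡⟨ ℕ.*-suc d n ⟨
      d * suc n        ∎
    final : d * d * n * suc n * suc n * (n * suc n) ≤ d * d * n * suc n * suc n * (d * d * e)
    final = begin
      d * d * n * suc n * suc n * (n * suc n)              ≡⟨ move₁ d n (suc n) ⟩
      r * r * (suc n * (suc n * suc n))                    ≤⟨ ℕ.*-monoʳ-≤ (r * r) (ℕ.*-mono-≤ n<a (ℕ.*-mono-≤ n<a n<a)) ⟩
      r * r * (a * (a * a))                                ≤⟨ cancel-s ⟩
      d * q * (d * q * a′)                                 ≤⟨ ℕ.*-mono-≤ dq≤ (ℕ.*-mono-≤ dq≤ a′≤) ⟩
      d * (d * suc n) * (d * (d * suc n) * (e * n))        ≡⟨ move₂ d e n (suc n) ⟩
      d * d * n * suc n * suc n * (d * d * e)              ∎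
      where
      dq≤ = ℕ.*-monoʳ-≤ d q≤
      move₁ : ∀ d n m → d * d * n * m * m * (n * m) ≡ d * n * (d * n) * (m * (m * m))
      move₁ = solve-∀
      move₂ : ∀ d e n m → d * (d * m) * (d * (d * m) * (e * n)) ≡ d * d * n * m * m * (d * d * e)
      move₂ = solve-∀

  module ManyElements {e n : ℕ} (F : FieldOn (Fin (suc (suc e * n)))) (1≤n : 1 ≤ n) where
    open FiniteFieldTheory F
      renaming (_+_ to _⊕_; _*_ to _⊛_; -_ to ⊝_)
    open Variance F using (q; sum-translate; sum-negate; sum-over-nonzero-powers)

    private
      d = suc e
      r = d * n
      1≤d : 1 ≤ d
      1≤d = s≤s z≤n
      S = SumOfPowers d
      S? : ∀ s → Decidable (S s)
      S? = sumOfPowers? d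
      -A? : Decidable (λ x → S 1 (⊝ x))
      -A? x = S? 1 (⊝ x)

    open Sumset F d 1≤d

    count-negate : count -A? ≡ count (S? 1)
    count-negate = ℤ.+-injective (trans (sym (sum-𝟙 -A?))
      (trans (sum-negate (λ x → 𝟙 (S? 1 x))) (sum-𝟙 (S? 1))))

    -- The dn nonzero elements have nonzero powers, and no value is taken more than d times, so
    -- there are at least n nonzero powers; 0 is one more. G is the indicator of the nonzero part of
    -- A.
    many-powers : suc n ≤ count (S? 1)
    many-powers = lemma (count (S? 1)) refl
      where
      G : K → ℤ
      G m = 𝟙 (S? 1 m) ℤ.- 𝟙 (m Fin.≟ 0#)
      0≤G : ∀ m → 0ℤ ℤ.≤ G m
      0≤G m = ℤ.i≤j⇒0≤j-i (𝟙-mono (m Fin.≟ 0#) (S? 1 m) (λ { refl → sumOfPowers-0 d 1≤d 1 }))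
      G≡1 : ∀ z → z ≢ 0# → G (z ^ d) ≡ 1ℤ
      G≡1 z z≢0 = cong₂ ℤ._-_ (𝟙-yes (S? 1 (z ^ d)) (power-isSum d z)) (𝟙-no (z ^ d Fin.≟ 0#) (^-nonzero d z≢0))
      ∑G : sum G ≡ pos (count (S? 1)) ℤ.- 1ℤ
      ∑G = begin
        sum G
          ≡⟨ sum-cong (λ m → sym (cong₂ ℤ._-_ (ℤ.*-identityˡ (𝟙 (S? 1 m))) (ℤ.*-identityˡ (𝟙 (m Fin.≟ 0#))))) ⟩
        sum (λ m → 1ℤ ℤ.* 𝟙 (S? 1 m) ℤ.- 1ℤ ℤ.* 𝟙 (m Fin.≟ 0#))
          ≡⟨ sum-linear 1ℤ 1ℤ (λ m → 𝟙 (S? 1 m)) (λ m → 𝟙 (m Fin.≟ 0#)) ⟩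
        1ℤ ℤ.* sum (λ m → 𝟙 (S? 1 m)) ℤ.- 1ℤ ℤ.* sum (λ m → 𝟙 (m Fin.≟ 0#))
          ≡⟨ cong₂ ℤ._-_ (trans (ℤ.*-identityˡ _) (sum-𝟙 (S? 1)))
               (trans (ℤ.*-identityˡ _) (trans (sum-single _ 0# (λ j → 𝟙-no (j Fin.≟ 0#))) (𝟙-yes (0# Fin.≟ 0#) refl))) ⟩
        pos (count (S? 1)) ℤ.- 1ℤ ∎
        where open ≡-Reasoning
      lemma : ∀ c → count (S? 1) ≡ c → suc n ≤ count (S? 1)
      lemma zero    eq = contradiction (subst (1 ≤_) eq (count-positive (S? 1) (sumOfPowers-0 d 1≤d 1))) λ ()
      lemma (suc c) eq = subst (suc n ≤_) (sym eq) (s≤s (ℕ.*-cancelˡ-≤ d (ℤ.drop‿+≤+ (begin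
        pos (d * n)              ≡⟨ ℤ.*-identityʳ _ ⟨
        pos r ℤ.* 1ℤ             ≤⟨ sum-over-nonzero-powers d 1≤d G 1ℤ 0≤G G≡1 ⟩
        pos d ℤ.* sum G          ≡⟨ cong (pos d ℤ.*_) (trans ∑G (cong (λ x → pos x ℤ.- 1ℤ) eq)) ⟩
        pos d ℤ.* pos c          ≡⟨ ℤ.pos-* d c ⟨
        pos (d * c)              ∎))))
        where open ℤ.≤-Reasoning

    private
      scale : ∀ z x → z ≢ 0# → S 1 (⊝ x) → S 1 (⊝ (z ^ d ⊛ x))
      scale z x z≢0 p = subst (S 1) (sym (-‿distribʳ-* (z ^ d) x)) (sumOfPowers-* d {1} z p)

      unscale : ∀ z x → z ≢ 0# → S 1 (⊝ (z ^ d ⊛ x)) → S 1 (⊝ x)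
      unscale z x z≢0 p with inverse z z≢0
      ... | z⁻¹ , zz⁻¹≡1 = subst (S 1) eq (sumOfPowers-* d {1} z⁻¹ p)
        where
        open ≡-Reasoning
        eq : z⁻¹ ^ d ⊛ ⊝ (z ^ d ⊛ x) ≡ ⊝ x
        eq = begin
          z⁻¹ ^ d ⊛ ⊝ (z ^ d ⊛ x)      ≡⟨ cong (z⁻¹ ^ d ⊛_) (-‿distribʳ-* (z ^ d) x) ⟩
          z⁻¹ ^ d ⊛ (z ^ d ⊛ ⊝ x)      ≡⟨ *-assoc (z⁻¹ ^ d) (z ^ d) (⊝ x) ⟨
          z⁻¹ ^ d ⊛ z ^ d ⊛ ⊝ x        ≡⟨ cong (_⊛ ⊝ x) (trans (*-comm (z⁻¹ ^ d) (z ^ d)) (sym (^-distrib-* z z⁻¹ d))) ⟩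
          (z ⊛ z⁻¹) ^ d ⊛ ⊝ x          ≡⟨ cong (λ y → y ^ d ⊛ ⊝ x) zz⁻¹≡1 ⟩
          1# ^ d ⊛ ⊝ x                 ≡⟨ cong (_⊛ ⊝ x) (1^ d) ⟩
          1# ⊛ ⊝ x                     ≡⟨ *-identityˡ (⊝ x) ⟩
          ⊝ x                          ∎

      extend : ∀ s t v → S 1 (⊝ v) → S s (t ⊕ v) → S (suc s) t
      extend s t v p p′ = subst (S (suc s)) eq (sumOfPowers-+ d {1} {s} p p′)
        where
        open ≡-Reasoning
        eq : ⊝ v ⊕ (t ⊕ v) ≡ t
        eq = begin
          ⊝ v ⊕ (t ⊕ v)   ≡⟨ cong (⊝ v ⊕_) (+-comm t v) ⟩
          ⊝ v ⊕ (v ⊕ t)   ≡⟨ +-assoc (⊝ v) v t ⟨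
          ⊝ v ⊕ v ⊕ t     ≡⟨ cong (_⊕ t) (-‿inverseˡ v) ⟩
          0# ⊕ t          ≡⟨ +-identityˡ t ⟩
          t               ∎

    -- Correlations count differences, so adding A means taking V = -A; `count-negate` then restores
    -- |A|.
    growth : ∀ s {a′ c′} → count (S? s) + a′ ≡ suc r → count (S? (suc s)) + c′ ≡ suc r →
      r * (count (S? 1) * count (S? s) * c′) ≤ d * (suc r * (count (S? (suc s)) * a′))
    growth s {a′} {c′} eqᵃ eqᶜ = subst (λ b → r * (b * count (S? s) * c′) ≤ d * (suc r * (count (S? (suc s)) * a′))) count-negate
      (sumset-bound (S? s) -A? (S? (suc s)) unscale scale (extend s)
        (count-positive (S? s) (sumOfPowers-0 d 1≤d s))
        (count-positive -A? {⊝ 0#} (subst (S 1) (sym (-‿involutive 0#)) (sumOfPowers-0 d 1≤d 1)))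
        (count-positive (S? (suc s)) (sumOfPowers-0 d 1≤d (suc s))) eqᵃ eqᶜ)

    -- If x is not in 2sA, then sA and x - sA are disjoint sets of the same size.
    half : ∀ s {x} → ¬ S (s + s) x → count (S? s) + count (S? s) ≤ suc r
    half s {x} ¬p = ℤ.drop‿+≤+ (begin
      pos (count (S? s) + count (S? s))
        ≡⟨ ℤ.pos-+ (count (S? s)) (count (S? s)) ⟩
      pos (count (S? s)) ℤ.+ pos (count (S? s))
        ≡⟨ cong₂ ℤ._+_ (sum-𝟙 (S? s)) (trans reflected (sum-𝟙 (S? s))) ⟨
      sum (λ y → 𝟙 (S? s y)) ℤ.+ sum (λ y → 𝟙 (S? s (⊝ y ⊕ x)))
        ≡⟨ sum-+ _ _ ⟨
      sum (λ y → 𝟙 (S? s y) ℤ.+ 𝟙 (S? s (⊝ y ⊕ x)))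
        ≤⟨ sum-mono at-most-one ⟩
      sum {suc r} (λ y → 1ℤ)
        ≡⟨ trans (sum-const (suc r) 1ℤ) (ℤ.*-identityʳ (pos (suc r))) ⟩
      pos (suc r) ∎)
      where
      open ℤ.≤-Reasoning
      reflected : sum (λ y → 𝟙 (S? s (⊝ y ⊕ x))) ≡ sum (λ y → 𝟙 (S? s y))
      reflected = trans (sum-negate (λ y → 𝟙 (S? s (y ⊕ x)))) (sum-translate (λ y → 𝟙 (S? s y)) x)
      at-most-one : ∀ y → 𝟙 (S? s y) ℤ.+ 𝟙 (S? s (⊝ y ⊕ x)) ℤ.≤ 1ℤ
      at-most-one y with S? s y | S? s (⊝ y ⊕ x)
      ... | yes p | yes p′ = contradiction (subst (S (s + s)) sum≡x (sumOfPowers-+ d {s} {s} p p′)) ¬p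
        where
        sum≡x : y ⊕ (⊝ y ⊕ x) ≡ x
        sum≡x = trans (sym (+-assoc y (⊝ y) x)) (trans (cong (_⊕ x) (-‿inverseʳ y)) (+-identityˡ x))
      ... | yes _ | no _   = ℤ.≤-refl
      ... | no _  | yes _  = ℤ.≤-refl
      ... | no _  | no _   = +≤+ z≤n

    six-powers : d * d * e < n * suc n → ∀ x → S 6 x
    six-powers large x with S? 6 x
    ... | yes p = p
    -- If 6A misses x, then 3A fills at most half of the field.
    ... | no ¬p = contradiction
      (no-such-sizes {e} {n} 1≤n (positive 2) (positive 3) many-powers
        (ℕ.+-cancelˡ-≤ (count (S? 3)) (count (S? 3)) (suc r ∸ count (S? 3)) (subst (count (S? 3) + count (S? 3) ≤_) (sym (complement 3)) (half 3 ¬p)))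
        (complement 1) (growth 1 (complement 1) (complement 2)) (growth 2 (complement 2) (complement 3)))
      (ℕ.<⇒≱ large)
      where
      positive : ∀ s → 1 ≤ count (S? s)
      positive s = count-positive (S? s) (sumOfPowers-0 d 1≤d s)
      complement : ∀ s → count (S? s) + (suc r ∸ count (S? s)) ≡ suc r
      complement s = ℕ.m+[n∸m]≡n (count-≤ (S? s))

-- The search through cosets and the checks of its result.

module CosetSearch where
  open import Defs
  open import Data.Bool.Base using (Bool; true; false; _∧_; _∨_; not; if_then_else_)
  open import Data.Bool.ListAction using (any; all)
  open import Data.Nat.Base
  open import Data.Nat.DivMod using (_/_; _%_)
  open import Data.Nat.GCD using (gcd)
  open import Data.Nat.Binary.Base as ℕᵇ using (ℕᵇ; 2[1+_]; 1+[2_]; fromℕ)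
  open import Data.List.Base using (List; []; _∷_; map; upTo; foldr)
  open import Data.Vec.Base using (Vec; []; _∷_; _∷ʳ_; zipWith)
  open import Function.Base using (_∘_)
  open import Data.Product.Base using (_×_; _,_; proj₂; ∃-syntax)
  open import Relation.Binary.PropositionalEquality using (_≡_)

  -- Operations alone: ring laws are applied only to the images in the field. Subtraction is
  -- addition of a multiple of `-1r`.
  record Arithmetic : Set₁ where
    infixl 6 _⊕_
    infixl 7 _⊗_
    infix 4 _≡?_
    field
      R       : Set
      0r 1r   : R
      -1r     : R
      _⊕_ _⊗_ : R → R → R
      _≡?_    : R → R → Bool

  modular : ℕ → Arithmetic
  modular p′ = record
    { R = ℕ ; 0r = 0 ; 1r = 1 ; -1r = p′
    ; _⊕_ = λ a b → (a + b) % suc p′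
    ; _⊗_ = λ a b → (a * b) % suc p′
    ; _≡?_ = _≡ᵇ_ }

  -- F_p[X]/(X^(e+1) − rel) for p = p′ + 1, with the coefficient of X^e first.
  module Residues (p′ : ℕ) {e : ℕ} (rel : Vec ℕ (suc e)) where

    Poly : Set
    Poly = Vec ℕ (suc e)

    addScaled : ∀ {m} → ℕ → Vec ℕ m → Vec ℕ m → Vec ℕ m
    addScaled c = zipWith (λ r a → (a + c * r) % suc p′)

    -- Multiplication by X: the leading term c X^(e+1) becomes c times `rel`.
    shift : Poly → Poly
    shift (c ∷ cs) = addScaled c rel (cs ∷ʳ 0)

    const : ∀ {m} → ℕ → Vec ℕ (suc m)
    const {zero}  a = a ∷ []
    const {suc m} a = 0 ∷ const a

    horner : ∀ {m} → Poly → Poly → Vec ℕ m → Poly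
    horner b acc []       = acc
    horner b acc (a ∷ as) = horner b (addScaled a b (shift acc)) as

    equals : ∀ {m} → Vec ℕ m → Vec ℕ m → Bool
    equals []       []       = true
    equals (a ∷ as) (b ∷ bs) = (a ≡ᵇ b) ∧ equals as bs

    shifts : ℕ → Poly → Poly
    shifts zero    v = v
    shifts (suc n) v = shifts n (shift v)

    arithmetic : Arithmetic
    arithmetic = record
      { R = Poly ; 0r = const 0 ; 1r = const 1 ; -1r = const p′
      ; _⊕_ = addScaled 1 ; _⊗_ = λ a b → horner b (const 0) a ; _≡?_ = equals }

  data Verdict : Set where
    notPrimePower unreachable atMostSix invalid : Verdict
    exactly : ℕ → Verdict

  module Search (𝓡 : Arithmetic) (d n : ℕ) (n₂ q-1₂ : ℕᵇ) where
    open Arithmetic 𝓡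

    square : R → R
    square y = y ⊗ y

    _^ᵇ_ : R → ℕᵇ → R
    x ^ᵇ ℕᵇ.zero = 1r
    x ^ᵇ 2[1+ b ] = square (x ⊗ (x ^ᵇ b))
    x ^ᵇ 1+[2 b ] = x ⊗ square (x ^ᵇ b)

    isUnit : R → Bool
    isUnit x = x ^ᵇ q-1₂ ≡? 1r

    powers : ℕ → R → R → List R
    powers zero    u x = []
    powers (suc k) u x = x ∷ powers k u (u ⊗ x)

    -- The product of all x - y, so that a single unit test separates x from the whole list.
    differences : R → List R → R
    differences x = foldr (λ y z → (x ⊕ -1r ⊗ y) ⊗ z) 1r

    hasOrder : ℕ → R → Bool
    hasOrder k u = (u ^ᵇ fromℕ k ≡? 1r) ∧ isUnit (differences 1r (powers (k ∸ 1) u u))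

    -- In an entry (l , r , v), r is a sum of l powers and v = rⁿ identifies its coset.
    Entry : Set
    Entry = ℕ × R × R

    isNew : R → List Entry → Bool
    isNew c []                 = true
    isNew c ((_ , _ , v) ∷ es) = if v ≡? c then false else isNew c es

    -- The second argument counts the cosets still missing, and the scan stops when it reaches 0.
    -- Entries are prepended, so the head always has the highest level. `visit` and `insert` receive
    -- the n-th power as an argument in order to share it.
    scan : ℕ → ℕ → List R → List Entry → ℕ × List Entry
    visit : ℕ → ℕ → R → R → List R → List Entry → ℕ × List Entry
    insert : ℕ → ℕ → R → R → List R → List Entry → Bool → ℕ × List Entry

    scan l zero    cs       es = zero , es
    scan l m       []       es = m , es
    scan l (suc m) (c ∷ cs) es = visit l m c (c ^ᵇ n₂) cs es

    visit l m c v cs es = insert l m c v cs es (if c ≡? 0r then false else isNew v es)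

    insert l m c v cs es true  = scan l m cs ((l , c , v) ∷ es)
    insert l m c v cs es false = scan l (suc m) cs es

    sums : List R → R → List R → List R
    sums []       r rest = rest
    sums (h ∷ hs) r rest = r ⊕ h ∷ sums hs r rest

    candidates : List R → List Entry → List R
    candidates hs []                 = []
    candidates hs ((_ , r , _) ∷ es) = sums hs r (candidates hs es)

    levels : List R → ℕ → ℕ → ℕ × List Entry → ℕ × List Entry
    advance : List R → ℕ → ℕ → ℕ → List Entry → ℕ × List Entry → ℕ × List Entry

    levels hs zero    l st           = st
    levels hs (suc f) l (zero , es)  = zero , es
    levels hs (suc f) l (suc m , es) = advance hs f l m es (scan (suc l) (suc m) (candidates hs es) es)

    -- A round without a new coset would repeat itself for ever.
    advance hs f l m es (m′ , es′) = if m′ ≡ᵇ suc m then (suc m , es) else levels hs f (suc l) (m′ , es′)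

    reached : List R → ℕ × List Entry
    -- The coset of 1 is known at level 1, which leaves d - 1. Every round either adds a coset or is
    -- the last, so at most d - 1 rounds are needed, and d ≤ 37.
    reached hs = levels hs 40 1 (d ∸ 1 , (1 , 1r , 1r) ∷ [])

    covered : ℕ → List Entry → R → Bool
    covered s []                 x = false
    covered s ((l , r , v) ∷ es) x = if v ≡? x then l ≤ᵇ s else covered s es x

    covers : List R → ℕ → List Entry → Bool
    covers xs s es = all (covered s es) xs

    lands : List Entry → ℕ → R → Bool
    lands es l c = if c ≡? 0r then true else covered (suc l) es (c ^ᵇ n₂)

    closedUnder : List R → List Entry → Entry → Bool
    closedUnder hs es (l , r , _) = all (λ h → lands es l (r ⊕ h)) hs

    -- Makes the levels lower bounds: by induction on s, every nonzero sum of s powers lies in a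
    -- listed coset of level at most s.
    closed : List R → List Entry → Bool
    closed hs es = covered 1 es 1r ∧ all (closedUnder hs es) es

    below : ℕ → List Entry → List Entry
    below m []                 = []
    below m ((l , r , v) ∷ es) = if l <ᵇ m then (l , r , v) ∷ below m es else below m es

    avoids : List Entry → R → Bool
    avoids es t = isUnit t ∧ isUnit (differences (t ^ᵇ n₂) (map (proj₂ ∘ proj₂) es))

    judge : R → List R → List R → ℕ × List Entry → Verdict
    -- The search got stuck. A primitive θ lies in no proper subfield, hence is the natural witness.
    judge θ xs hs (suc _ , es)  = if closed hs es ∧ avoids es θ then unreachable else invalid
    judge θ xs hs (zero , [])   = invalid
    -- The head was inserted last: m is the largest level, and t needs that many powers.
    judge θ xs hs (zero , es@((m , t , _) ∷ _)) =
      if m ≤ᵇ 6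
      then (if covers xs 6 es then atMostSix else invalid)
      else (if covers xs m es ∧ (closed hs es ∧ avoids (below m es) t) then exactly m else invalid)

    conclude : R → R → List R → Verdict
    conclude θ ω hs = judge θ (powers d ω 1r) hs (reached hs)

    -- In a field with dn + 1 elements both orders are as tested exactly when θ is primitive. Then
    -- the powers of ω are the values of xⁿ that tell the cosets apart, and the powers of η are the
    -- nonzero d-th powers.
    verdictFor : R → R → R → Verdict
    verdictFor θ ω η =
      if hasOrder d ω ∧ hasOrder n η then conclude θ ω (powers n η 1r) else invalid

    verdict : R → Verdict
    verdict θ = verdictFor θ (θ ^ᵇ n₂) (θ ^ᵇ fromℕ d)

  module PrimeField (d n : ℕ) (n₂ q-1₂ : ℕᵇ) where
    open Search (modular (d * n)) d n n₂ q-1₂ public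

    try : ℕ → ℕ → Verdict
    orTryNext : ℕ → ℕ → Verdict → Verdict

    try zero    g = invalid
    try (suc f) g = orTryNext f g (verdict g)

    orTryNext f g invalid = try f (suc g)
    orTryNext f g v       = v

  -- (p − 1 , e − 1 , rel) stands for the field F_p[X]/(X^e − rel), in which X is primitive.
  extensions : List (∃[ p′ ] ∃[ e ] Vec ℕ (suc e))
  extensions =
    (1 , 1 , 1 ∷ 1 ∷ []) ∷
    (1 , 2 , 1 ∷ 0 ∷ 1 ∷ []) ∷
    (1 , 3 , 1 ∷ 0 ∷ 0 ∷ 1 ∷ []) ∷
    (1 , 4 , 0 ∷ 1 ∷ 0 ∷ 0 ∷ 1 ∷ []) ∷
    (1 , 5 , 1 ∷ 0 ∷ 0 ∷ 0 ∷ 0 ∷ 1 ∷ []) ∷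
    (1 , 7 , 0 ∷ 1 ∷ 1 ∷ 1 ∷ 0 ∷ 0 ∷ 0 ∷ 1 ∷ []) ∷
    (1 , 9 , 0 ∷ 0 ∷ 1 ∷ 0 ∷ 0 ∷ 0 ∷ 0 ∷ 0 ∷ 0 ∷ 1 ∷ []) ∷
    (1 , 10 , 0 ∷ 1 ∷ 0 ∷ 0 ∷ 0 ∷ 0 ∷ 0 ∷ 0 ∷ 0 ∷ 0 ∷ 1 ∷ []) ∷
    (1 , 11 , 1 ∷ 0 ∷ 0 ∷ 1 ∷ 0 ∷ 1 ∷ 0 ∷ 0 ∷ 0 ∷ 0 ∷ 0 ∷ 1 ∷ []) ∷
    (2 , 1 , 1 ∷ 1 ∷ []) ∷
    (2 , 2 , 1 ∷ 0 ∷ 2 ∷ []) ∷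
    (2 , 3 , 1 ∷ 0 ∷ 0 ∷ 1 ∷ []) ∷
    (2 , 4 , 1 ∷ 0 ∷ 0 ∷ 0 ∷ 2 ∷ []) ∷
    (2 , 5 , 1 ∷ 0 ∷ 0 ∷ 0 ∷ 0 ∷ 1 ∷ []) ∷
    (4 , 1 , 2 ∷ 2 ∷ []) ∷
    (4 , 2 , 1 ∷ 0 ∷ 2 ∷ []) ∷
    (4 , 3 , 1 ∷ 2 ∷ 0 ∷ 2 ∷ []) ∷
    (6 , 1 , 2 ∷ 2 ∷ []) ∷
    (6 , 2 , 1 ∷ 0 ∷ 3 ∷ []) ∷
    (6 , 3 , 1 ∷ 1 ∷ 0 ∷ 2 ∷ []) ∷
    (10 , 1 , 1 ∷ 3 ∷ []) ∷
    (10 , 2 , 1 ∷ 0 ∷ 2 ∷ []) ∷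
    (12 , 1 , 4 ∷ 2 ∷ []) ∷
    (12 , 2 , 1 ∷ 0 ∷ 2 ∷ []) ∷
    (16 , 1 , 4 ∷ 3 ∷ []) ∷
    (18 , 1 , 4 ∷ 4 ∷ []) ∷
    (22 , 1 , 5 ∷ 2 ∷ []) ∷
    (28 , 1 , 2 ∷ 2 ∷ []) ∷
    (30 , 1 , 1 ∷ 7 ∷ []) ∷
    (36 , 1 , 3 ∷ 2 ∷ []) ∷
    (40 , 1 , 6 ∷ 6 ∷ []) ∷
    (42 , 1 , 1 ∷ 9 ∷ []) ∷
    (46 , 1 , 5 ∷ 2 ∷ []) ∷
    (52 , 1 , 5 ∷ 2 ∷ []) ∷
    (58 , 1 , 1 ∷ 3 ∷ []) ∷
    (60 , 1 , 3 ∷ 2 ∷ []) ∷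
    (66 , 1 , 2 ∷ 4 ∷ []) ∷
    (70 , 1 , 3 ∷ 2 ∷ []) ∷
    (72 , 1 , 1 ∷ 5 ∷ []) ∷
    []

  -- Checks X^(q-1) = 1 modulo f: `rel` is already X^(e+1), which leaves q - e - 2 shifts. The guard
  -- makes the truncated subtraction exact. That X has no smaller order is tested in `verdictFor`.
  isPrimitive : ∃[ p′ ] ∃[ e ] Vec ℕ (suc e) → Bool
  isPrimitive (p′ , e , rel) = (suc (suc e) ≤ᵇ suc p′ ^ suc e) ∧ equals (shifts (suc p′ ^ suc e ∸ suc (suc e)) rel) (const 1)
    where open Residues p′ rel

  splitsAt : ℕ → ℕ → Bool
  splitsAt q zero    = false
  splitsAt q (suc a) with q % suc a
  ... | zero  = (1 <ᵇ q / suc a) ∧ (1 <ᵇ suc a) ∧ (gcd (suc a) (q / suc a) ≡ᵇ 1)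
  ... | suc _ = false

  -- A number q < 91² that is not a prime power has coprime factors a , q / a > 1 with a < 91.
  splits : ℕ → Bool
  splits q = any (splitsAt q) (upTo 91)

  classifyWith : (d n : ℕ) → ℕᵇ → ℕᵇ → List (∃[ p′ ] ∃[ e ] Vec ℕ (suc e)) → Verdict
  -- Candidates for a primitive root modulo q are 2, ..., 61.
  classifyWith d n n₂ q-1₂ []                     = PrimeField.try d n n₂ q-1₂ 60 2
  classifyWith d n n₂ q-1₂ ((p′ , e , rel) ∷ ext) =
    if suc p′ ^ suc e ≡ᵇ suc (d * n)
    -- The shift of the constant 1 is the residue class of X.
    then Search.verdict (Residues.arithmetic p′ rel) d n n₂ q-1₂ (Residues.shift p′ rel (Residues.const p′ rel 1))
    else classifyWith d n n₂ q-1₂ ext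

  opaque
    -- Opaque, so that the search runs only where it is unfolded for evaluation and not whenever
    -- types mentioning it are compared.
    classify : ℕ → ℕ → Verdict
    classify d n = if splits (suc (d * n)) then notPrimePower else classifyWith d n (fromℕ n) (fromℕ (d * n)) extensions

  listed : ℕ → ℕ → ℕ → Bool
  listed k q m = any (λ (k′ , q′ , m′) → (k ≡ᵇ k′) ∧ (q ≡ᵇ q′) ∧ (m ≡ᵇ m′)) largeWaringNumbers

  -- One verdict for (d, n) settles all k with gcd(k, q - 1) = d, so each such k in the range must
  -- be listed with the same m.
  acceptable : ℕ → ℕ → Verdict → Bool
  acceptable d n invalid     = false
  acceptable d n (exactly m) =
    all (λ k → (k <ᵇ 4) ∨ not (gcd k (d * n) ≡ᵇ d) ∨ listed k (suc (d * n)) m) (upTo 38)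
  acceptable d n _           = true

  checked : ℕ → ℕ → Bool
  checked d n = (d * d * (d ∸ 1) <ᵇ n * suc n) ∨ acceptable d n (classify d n)

  -- n(n + 1) > d²(d − 1) holds for all n > 223 when d ≤ 37, so the bound b = 223 will suffice.
  checkedUpTo : ℕ → List ℕ → Bool
  checkedUpTo b = all (λ d → all (λ n → checked (suc d) (suc n)) (upTo b))

  isExactly : ℕ → Verdict → Bool
  isExactly m (exactly m′) = m ≡ᵇ m′
  isExactly m _            = false

  cofactor : ℕ → ℕ → ℕ
  cofactor zero    r = 0
  cofactor (suc d) r = r / suc d

  -- The converse of `checked`: the listed values do occur.
  confirmed : ℕ × ℕ × ℕ → Bool
  confirmed (k , q , m) = isExactly m (classify (gcd k (q ∸ 1)) (cofactor (gcd k (q ∸ 1)) (q ∸ 1)))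

-- Soundness of the verdicts, given a homomorphism into the field.

module SearchSoundness where
  open import Data.Bool.Base using (Bool; true; false; _∧_; if_then_else_; T)
  open import Data.Bool.ListAction using (all)
  open import Data.Empty using (⊥)
  open import Data.Fin.Base as Fin using (Fin; toℕ; fromℕ<)
  import Data.Fin.Properties as Fin
  open import Data.List.Base using (List; []; _∷_; map)
  open import Data.List.Membership.Propositional using (_∈_)
  open import Data.List.Relation.Unary.All as All using (All; []; _∷_)
  import Data.List.Relation.Unary.All.Properties as All
  open import Data.List.Relation.Unary.Any using (here; there)
  open import Data.Nat.Base as ℕ using (ℕ; zero; suc; _≤_; _<_; z≤n; s≤s; _∸_; _≤ᵇ_; _<ᵇ_; _≡ᵇ_)
  open import Data.Nat.Binary.Base as ℕᵇ using (ℕᵇ; 2[1+_]; 1+[2_]; fromℕ)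
  import Data.Nat.Binary.Properties as ℕᵇ
  import Data.Nat.Properties as ℕ
  open import Data.Product.Base using (_×_; _,_; proj₁; proj₂; ∃-syntax)
  open import Data.Sum.Base using (_⊎_; inj₁; inj₂)
  open import Data.Unit.Base using (⊤; tt)
  open import Relation.Binary.PropositionalEquality
  open import Relation.Nullary using (¬_; Dec; yes; no; contradiction)
  open CosetSearch
  open Fields

  ∧-true : ∀ {a b} → a ∧ b ≡ true → a ≡ true × b ≡ true
  ∧-true {true} {true} refl = refl , refl

  ≤ᵇ-true : ∀ {m n} → (m ≤ᵇ n) ≡ true → m ≤ n
  ≤ᵇ-true {m} {n} eq = ℕ.≤ᵇ⇒≤ m n (subst T (sym eq) tt)

  <ᵇ-true : ∀ {m n} → (m <ᵇ n) ≡ true → m < n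
  <ᵇ-true {m} {n} eq = ℕ.<ᵇ⇒< m n (subst T (sym eq) tt)

  all-true : ∀ {A : Set} (p : A → Bool) {xs x} → all p xs ≡ true → x ∈ xs → p x ≡ true
  all-true p {y ∷ xs} eq (here refl) = proj₁ (∧-true {p y} eq)
  all-true p {y ∷ xs} eq (there x∈)  = all-true p (proj₂ (∧-true {p y} eq)) x∈

  module Model (d n : ℕ) (F : FieldOn (Fin (suc (d ℕ.* n)))) (1≤d : 1 ≤ d) (1≤n : 1 ≤ n) where
    open FiniteFieldTheory F

    -- `notPrimePower` contradicts the hypothesis on q, hence ⊥; `invalid` promises nothing and is
    -- ruled out by evaluation.
    Meaning : Verdict → Set
    Meaning notPrimePower = ⊥
    Meaning unreachable   = ∃[ t ] ∀ s → ¬ SumOfPowers d s t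
    Meaning atMostSix     = ∀ x → SumOfPowers d 6 x
    Meaning (exactly m)   = 7 ≤ m × (∀ x → SumOfPowers d m x) × (∃[ t ] ∀ s → s < m → ¬ SumOfPowers d s t)
    Meaning invalid       = ⊤

    if-sound : ∀ b {v w} → (b ≡ true → Meaning v) → (b ≡ false → Meaning w) → Meaning (if b then v else w)
    if-sound true  f g = f refl
    if-sound false f g = g refl

    record Interpretation (𝓡 : Arithmetic) : Set where
      open Arithmetic 𝓡
      field
        φ    : R → K
        φ-0  : φ 0r ≡ 0#
        φ-1  : φ 1r ≡ 1#
        φ--1 : φ -1r + 1# ≡ 0#
        φ-+  : ∀ x y → φ (x ⊕ y) ≡ φ x + φ y
        φ-*  : ∀ x y → φ (x ⊗ y) ≡ φ x * φ y
        φ-≡  : ∀ {x y} → (x ≡? y) ≡ true → φ x ≡ φ y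

    module Soundness {𝓡 : Arithmetic} (I : Interpretation 𝓡) (n₂ q-1₂ : ℕᵇ)
                     (n₂≡n : ℕᵇ.toℕ n₂ ≡ n) (q-1₂≡dn : ℕᵇ.toℕ q-1₂ ≡ d ℕ.* n) where
      open Arithmetic 𝓡
      open Interpretation I
      open Search 𝓡 d n n₂ q-1₂

      open ≡-Reasoning

      φ-^ : ∀ x b → φ (x ^ᵇ b) ≡ φ x ^ ℕᵇ.toℕ b
      φ-square : ∀ y → φ (square y) ≡ φ y ^ 2

      φ-square y = trans (φ-* y y) (cong (φ y *_) (sym (*-identityʳ (φ y))))

      φ-^ x ℕᵇ.zero  = φ-1
      φ-^ x 2[1+ b ] = begin
        φ (square (x ⊗ (x ^ᵇ b)))        ≡⟨ φ-square _ ⟩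
        φ (x ⊗ (x ^ᵇ b)) ^ 2             ≡⟨ cong (_^ 2) (trans (φ-* x _) (cong (φ x *_) (φ-^ x b))) ⟩
        (φ x ^ suc (ℕᵇ.toℕ b)) ^ 2       ≡⟨ ^-assocʳ (φ x) (suc (ℕᵇ.toℕ b)) 2 ⟩
        φ x ^ (suc (ℕᵇ.toℕ b) ℕ.* 2)     ≡⟨ cong (φ x ^_) (ℕ.*-comm (suc (ℕᵇ.toℕ b)) 2) ⟩
        φ x ^ (2 ℕ.* suc (ℕᵇ.toℕ b))     ∎
      φ-^ x 1+[2 b ] = begin
        φ (x ⊗ square (x ^ᵇ b))          ≡⟨ φ-* x _ ⟩
        φ x * φ (square (x ^ᵇ b))        ≡⟨ cong (φ x *_) (trans (φ-square _) (cong (_^ 2) (φ-^ x b))) ⟩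
        φ x * (φ x ^ ℕᵇ.toℕ b) ^ 2       ≡⟨ cong (φ x *_) (^-assocʳ (φ x) (ℕᵇ.toℕ b) 2) ⟩
        φ x * φ x ^ (ℕᵇ.toℕ b ℕ.* 2)     ≡⟨ cong (λ k → φ x * φ x ^ k) (ℕ.*-comm (ℕᵇ.toℕ b) 2) ⟩
        φ x * φ x ^ (2 ℕ.* ℕᵇ.toℕ b)     ∎

      φ-^ℕ : ∀ x k → φ (x ^ᵇ fromℕ k) ≡ φ x ^ k
      φ-^ℕ x k = trans (φ-^ x (fromℕ k)) (cong (φ x ^_) (ℕᵇ.toℕ-fromℕ k))

      φ-^n : ∀ x → φ (x ^ᵇ n₂) ≡ φ x ^ n
      φ-^n x = trans (φ-^ x n₂) (cong (φ x ^_) n₂≡n)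

      isUnit-sound : ∀ {x} → isUnit x ≡ true → φ x ≢ 0#
      isUnit-sound {x} eq = ^≡1⇒≢0 {n = d ℕ.* n} (ℕ.*-mono-≤ 1≤d 1≤n)
        (trans (cong (φ x ^_) (sym q-1₂≡dn)) (trans (sym (φ-^ x q-1₂)) (trans (φ-≡ eq) φ-1)))

      powers-sound : ∀ {P : R → Set} k u x → All P (powers k u x) →
                     ∀ (i : Fin k) → ∃[ h ] P h × φ h ≡ φ u ^ toℕ i * φ x
      powers-sound (suc k) u x (px ∷ _)  Fin.zero    = x , px , sym (*-identityˡ (φ x))
      powers-sound (suc k) u x (_ ∷ pxs) (Fin.suc i) with powers-sound k u (u ⊗ x) pxs i
      ... | h , ph , eq = h , ph , (begin
        φ h                          ≡⟨ eq ⟩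
        φ u ^ toℕ i * φ (u ⊗ x)      ≡⟨ cong (φ u ^ toℕ i *_) (φ-* u x) ⟩
        φ u ^ toℕ i * (φ u * φ x)    ≡⟨ *-assoc _ _ _ ⟨
        φ u ^ toℕ i * φ u * φ x      ≡⟨ cong (_* φ x) (*-comm _ _) ⟩
        φ u * φ u ^ toℕ i * φ x      ∎)

      powers-all : ∀ k u x → All (λ h → ∃[ i ] φ h ≡ φ u ^ i * φ x) (powers k u x)
      powers-all zero    u x = []
      powers-all (suc k) u x = (0 , sym (*-identityˡ (φ x))) ∷ All.map step (powers-all k u (u ⊗ x))
        where
        step : ∀ {h} → ∃[ i ] φ h ≡ φ u ^ i * φ (u ⊗ x) → ∃[ i ] φ h ≡ φ u ^ i * φ x
        step (i , eq) = suc i , trans eq (trans (cong (φ u ^ i *_) (φ-* u x))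
          (solve 3 (λ a b c → a :* (b :* c) := b :* a :* c) refl (φ u ^ i) (φ u) (φ x)))

      differences-sound : ∀ x ys → φ (differences x ys) ≢ 0# → All (λ y → φ x ≢ φ y) ys
      differences-sound x []       _  = []
      differences-sound x (y ∷ ys) ≢0 = x≢y ∷ differences-sound x ys (nonzeroʳ product≢0)
        where
        product≢0 : φ (x ⊕ -1r ⊗ y) * φ (differences x ys) ≢ 0#
        product≢0 eq = ≢0 (trans (φ-* _ _) eq)
        x≢y : φ x ≢ φ y
        x≢y eq = nonzeroˡ product≢0 (begin
          φ (x ⊕ -1r ⊗ y)          ≡⟨ trans (φ-+ _ _) (cong (φ x +_) (φ-* _ _)) ⟩
          φ x + φ -1r * φ y        ≡⟨ cong (_+ φ -1r * φ y) eq ⟩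
          φ y + φ -1r * φ y        ≡⟨ cong (_+ φ -1r * φ y) (*-identityˡ (φ y)) ⟨
          1# * φ y + φ -1r * φ y   ≡⟨ distribʳ (φ y) 1# (φ -1r) ⟨
          (1# + φ -1r) * φ y       ≡⟨ cong (_* φ y) (trans (+-comm 1# (φ -1r)) φ--1) ⟩
          0# * φ y                 ≡⟨ zeroˡ (φ y) ⟩
          0#                       ∎)

      hasOrder-sound : ∀ {k u} → 1 ≤ k → hasOrder k u ≡ true → HasOrder k (φ u)
      hasOrder-sound {k@(suc k-1)} {u} 1≤k eq = record
        { positive = 1≤k
        ; ^k≡1     = trans (sym (φ-^ℕ u k)) (trans (φ-≡ (proj₁ split)) φ-1)
        ; minimal  = minimal
        }
        where
        split = ∧-true {u ^ᵇ fromℕ k ≡? 1r} eq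
        minimal : ∀ {i} → 1 ≤ i → i < k → φ u ^ i ≢ 1#
        minimal {suc i} _ (s≤s i<k) uⁱ≡1
          with powers-sound k-1 u u (differences-sound 1r _ (isUnit-sound (proj₂ split))) (fromℕ< i<k)
        ... | h , 1≢h , h≡ = 1≢h (begin
          φ 1r                                     ≡⟨ φ-1 ⟩
          1#                                       ≡⟨ uⁱ≡1 ⟨
          φ u * φ u ^ i                            ≡⟨ *-comm _ _ ⟩
          φ u ^ i * φ u                            ≡⟨ cong (λ j → φ u ^ j * φ u) (Fin.toℕ-fromℕ< i<k) ⟨
          φ u ^ toℕ (fromℕ< i<k) * φ u             ≡⟨ h≡ ⟨
          φ h                                      ∎)

      -- Claims only that l powers suffice for r; that fewer do not is the business of `closed`.
      Good : ℕ → Entry → Set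
      Good b (l , r , v) = l ≤ b × SumOfPowers d l (φ r) × φ v ≡ φ r ^ n

      scan-sound : ∀ l m {cs es} → All (λ c → SumOfPowers d l (φ c)) cs → All (Good l) es →
                   All (Good l) (proj₂ (scan l m cs es))
      scan-sound l zero    pcs pes = pes
      scan-sound l (suc m) []  pes = pes
      scan-sound l (suc m) {c ∷ cs} {es} (pc ∷ pcs) pes
        with if c ≡? 0r then false else isNew (c ^ᵇ n₂) es
      ... | true  = scan-sound l m pcs ((ℕ.≤-refl , pc , φ-^n c) ∷ pes)
      ... | false = scan-sound l (suc m) pcs pes

      module _ (hs : List R) (hs-powers : All (λ h → SumOfPowers d 1 (φ h)) hs) where

        sums-sound : ∀ {l} gs {r rest} → All (λ h → SumOfPowers d 1 (φ h)) gs → SumOfPowers d l (φ r) →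
                     All (λ c → SumOfPowers d (suc l) (φ c)) rest →
                     All (λ c → SumOfPowers d (suc l) (φ c)) (sums gs r rest)
        sums-sound []           _          pr prest = prest
        sums-sound {l} (g ∷ gs) {r} (pg ∷ pgs) pr prest =
          subst (SumOfPowers d (suc l)) (trans (+-comm (φ g) (φ r)) (sym (φ-+ r g))) (sumOfPowers-+ d {1} {l} pg pr)
          ∷ sums-sound gs pgs pr prest

        candidates-sound : ∀ {l} es → All (Good l) es → All (λ c → SumOfPowers d (suc l) (φ c)) (candidates hs es)
        candidates-sound []             []                    = []
        candidates-sound ((_ , r , _) ∷ es) ((l′≤l , pr , _) ∷ pes) =
          -- Entries of lower level are padded with zeros, so that all candidates of a round have
          -- the same number of summands.
          sums-sound hs hs-powers (sumOfPowers-≤ d 1≤d l′≤l pr) (candidates-sound es pes)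

        raise : ∀ {b b′ es} → b ≤ b′ → All (Good b) es → All (Good b′) es
        raise b≤b′ = All.map (λ (l≤b , rest) → ℕ.≤-trans l≤b b≤b′ , rest)

        levels-sound : ∀ f l m es → All (Good l) es → ∃[ b ] All (Good b) (proj₂ (levels hs f l (m , es)))
        levels-sound zero    l m       es pes = l , pes
        levels-sound (suc f) l zero    es pes = l , pes
        levels-sound (suc f) l (suc m) es pes
          with scan (suc l) (suc m) (candidates hs es) es
             | scan-sound (suc l) (suc m) (candidates-sound es pes) (raise (ℕ.n≤1+n l) pes)
        ... | m′ , es′ | pes′ with m′ ≡ᵇ suc m
        ...   | true  = l , pes
        ...   | false = levels-sound f (suc l) m′ es′ pes′

        reached-sound : ∃[ b ] All (Good b) (proj₂ (reached hs))
        reached-sound = levels-sound 40 1 (d ∸ 1) _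
          ((ℕ.≤-refl , subst (SumOfPowers d 1) (trans (1^ d) (sym φ-1)) (power-isSum d 1#)
                     , trans φ-1 (sym (trans (cong (_^ n) φ-1) (1^ n)))) ∷ [])

      covered-sound : ∀ {s x} es → covered s es x ≡ true →
                      ∃[ e ] e ∈ es × proj₁ e ≤ s × φ (proj₂ (proj₂ e)) ≡ φ x
      covered-sound {s} {x} ((l , r , v) ∷ es) eq with v ≡? x in v≡x
      ... | true  = (l , r , v) , here refl , ≤ᵇ-true eq , φ-≡ v≡x
      ... | false with covered-sound es eq
      ...   | e , e∈es , rest = e , there e∈es , rest

      below-sound : ∀ {m l r v} es → (l , r , v) ∈ es → l < m → (l , r , v) ∈ below m es
      below-sound {m} {l} ((l′ , _) ∷ es) e∈es l<m with l′ <ᵇ m in eq | e∈es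
      ... | true  | here refl  = here refl
      ... | true  | there e∈es = there (below-sound es e∈es l<m)
      ... | false | here refl  = contradiction (subst T eq (ℕ.<⇒<ᵇ l<m)) λ ()
      ... | false | there e∈es = below-sound es e∈es l<m

      module Orders {θ ω̂ η̂ : R} (ω≡θⁿ : φ ω̂ ≡ φ θ ^ n) (η≡θᵈ : φ η̂ ≡ φ θ ^ d)
                    (ω-order : HasOrder d (φ ω̂)) (η-order : HasOrder n (φ η̂)) where

        private
          ω η : K
          ω = φ ω̂
          η = φ η̂

        η-power : ∀ j → η ^ j ≡ (φ θ ^ j) ^ d
        η-power j = begin
          η ^ j                   ≡⟨ cong (_^ j) η≡θᵈ ⟩
          (φ θ ^ d) ^ j           ≡⟨ ^-assocʳ (φ θ) d j ⟩
          φ θ ^ (d ℕ.* j)         ≡⟨ cong (φ θ ^_) (ℕ.*-comm d j) ⟩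
          φ θ ^ (j ℕ.* d)         ≡⟨ ^-assocʳ (φ θ) j d ⟨
          (φ θ ^ j) ^ d           ∎

        η-power-^n : ∀ j → (η ^ j) ^ n ≡ 1#
        η-power-^n j = begin
          (η ^ j) ^ n             ≡⟨ cong (_^ n) (η-power j) ⟩
          ((φ θ ^ j) ^ d) ^ n     ≡⟨ ^-assocʳ (φ θ ^ j) d n ⟩
          (φ θ ^ j) ^ (d ℕ.* n)   ≡⟨ fermat (^-nonzero j (^-nonzero⁻¹ 1≤n θⁿ≢0)) ⟩
          1#                      ∎
          where
          θⁿ≢0 : φ θ ^ n ≢ 0#
          θⁿ≢0 eq = ^≡1⇒≢0 1≤d (HasOrder.^k≡1 ω-order) (trans ω≡θⁿ eq)

        -- The quotient of x and y is an n-th root of unity, and η generates these.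
        same-coset : ∀ {x y} → y ≢ 0# → x ^ n ≡ y ^ n → ∃[ j ] x ≡ η ^ toℕ {n} j * y
        same-coset {x} {y} y≢0 xⁿ≡yⁿ = proj₁ root , trans x≡yz (trans (*-comm y z) (cong (_* y) (proj₂ root)))
          where
          z = proj₁ (quotient x y≢0)
          x≡yz = proj₂ (quotient x y≢0)
          root : ∃[ j ] z ≡ η ^ toℕ {n} j
          root = roots-of-unity η-order (quotient-^ n y≢0 x≡yz xⁿ≡yⁿ)

        hs : List R
        hs = powers n η̂ 1r

        hs-powers : All (λ h → SumOfPowers d 1 (φ h)) hs
        hs-powers = All.map convert (powers-all n η̂ 1r)
          where
          convert : ∀ {h} → ∃[ i ] φ h ≡ η ^ i * φ 1r → SumOfPowers d 1 (φ h)
          convert {h} (i , eq) = subst (SumOfPowers d 1) (begin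
            (φ θ ^ i) ^ d     ≡⟨ η-power i ⟨
            η ^ i             ≡⟨ *-identityʳ _ ⟨
            η ^ i * 1#        ≡⟨ cong (η ^ i *_) φ-1 ⟨
            η ^ i * φ 1r      ≡⟨ eq ⟨
            φ h               ∎) (power-isSum d (φ θ ^ i))

        entry-reaches : ∀ {b s r v l x} → Good b (l , r , v) → l ≤ s → x ≢ 0# → x ^ n ≡ φ r ^ n →
                        SumOfPowers d s x
        entry-reaches {s = s} {r} {v} {l} {x} (_ , pr , _) l≤s x≢0 xⁿ≡rⁿ =
          subst (SumOfPowers d s) (sym (trans x≡ (cong (_* φ r) (η-power (toℕ j)))))
            (sumOfPowers-≤ d 1≤d l≤s (sumOfPowers-* d {l} (φ θ ^ toℕ j) pr))
          where
          r≢0 : φ r ≢ 0#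
          r≢0 = ^-nonzero⁻¹ 1≤n (λ eq → ^-nonzero n x≢0 (trans xⁿ≡rⁿ eq))
          coset = same-coset r≢0 xⁿ≡rⁿ
          j = proj₁ coset
          x≡ = proj₂ coset

        covered-sums : ∀ {s b es w x} → All (Good b) es → x ≢ 0# → covered s es w ≡ true → φ w ≡ x ^ n →
                       SumOfPowers d s x
        covered-sums {es = es} good x≢0 eq w≡xⁿ with covered-sound es eq
        ... | (l , r , v) , e∈es , l≤s , v≡w =
          entry-reaches {v = v} (All.lookup good e∈es) l≤s x≢0
            (trans (sym w≡xⁿ) (trans (sym v≡w) (proj₂ (proj₂ (All.lookup good e∈es)))))

        -- For x ≠ 0 the value xⁿ is a d-th root of unity, hence one of the d powers of ω that were
        -- checked.
        covers-sound : ∀ {s b es} → All (Good b) es → covers (powers d ω̂ 1r) s es ≡ true →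
                       ∀ x → SumOfPowers d s x
        covers-sound {s} {b} {es} good eq x = decide (x Fin.≟ 0#)
          where
          every : ∀ (i : Fin d) → ∃[ w ] covered s es w ≡ true × φ w ≡ ω ^ toℕ i * φ 1r
          every = powers-sound d ω̂ 1r (All.tabulate (all-true (covered s es) eq))
          decide : Dec (x ≡ 0#) → SumOfPowers d s x
          decide (yes x≡0) = subst (SumOfPowers d s) (sym x≡0) (sumOfPowers-0 d 1≤d s)
          decide (no x≢0)  = covered-sums good x≢0 (proj₁ (proj₂ found)) (begin
            φ (proj₁ found)     ≡⟨ proj₂ (proj₂ found) ⟩
            ω ^ toℕ i * φ 1r    ≡⟨ cong (ω ^ toℕ i *_) φ-1 ⟩
            ω ^ toℕ i * 1#      ≡⟨ *-identityʳ _ ⟩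
            ω ^ toℕ i           ≡⟨ proj₂ root ⟨
            x ^ n               ∎)
            where
            root : ∃[ i ] x ^ n ≡ ω ^ toℕ {d} i
            root = roots-of-unity ω-order (trans (^-assocʳ x n d) (trans (cong (x ^_) (ℕ.*-comm n d)) (fermat x≢0)))
            i = proj₁ root
            found = every i

        -- The set that a closed table proves to contain sA.
        Reached : List Entry → ℕ → K → Set
        Reached es s x = x ≡ 0# ⊎ (∃[ e ] e ∈ es × proj₁ e ≤ s × ∃[ j ] x ≡ η ^ j * φ (proj₁ (proj₂ e)))

        covered-reached : ∀ {b es s c x} → All (Good b) es → covered s es c ≡ true →
                          φ c ≡ x ^ n → x ≢ 0# → Reached es s x
        covered-reached {es = es} {x = x} good eq c≡xⁿ x≢0 with covered-sound es eq
        ... | (l , r , v) , e∈es , l≤s , v≡c = inj₂ (_ , e∈es , l≤s , toℕ (proj₁ coset) , proj₂ coset)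
          where
          xⁿ≡rⁿ : x ^ n ≡ φ r ^ n
          xⁿ≡rⁿ = trans (sym c≡xⁿ) (trans (sym v≡c) (proj₂ (proj₂ (All.lookup good e∈es))))
          coset = same-coset {x} {φ r} (^-nonzero⁻¹ 1≤n (λ eq′ → ^-nonzero n x≢0 (trans xⁿ≡rⁿ eq′))) xⁿ≡rⁿ

        scale-reached : ∀ {es s x} j → Reached es s x → Reached es s (η ^ j * x)
        scale-reached j (inj₁ refl) = inj₁ (zeroʳ (η ^ j))
        scale-reached j (inj₂ (e , e∈es , l≤s , i , refl)) =
          inj₂ (e , e∈es , l≤s , j ℕ.+ i , trans (sym (*-assoc _ _ _)) (cong (_* _) (sym (^-homo-* η j i))))

        raise-level : ∀ {es s s′ x} → s ≤ s′ → Reached es s x → Reached es s′ x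
        raise-level s≤s′ (inj₁ x≡0)                    = inj₁ x≡0
        raise-level s≤s′ (inj₂ (e , e∈es , l≤s , rest)) = inj₂ (e , e∈es , ℕ.≤-trans l≤s s≤s′ , rest)

        landed-reached : ∀ {b es l c} → All (Good b) es → lands es l c ≡ true → Reached es (suc l) (φ c)
        landed-reached {es = es} {l} {c} good landed with c ≡? 0r in is0
        ... | true  = inj₁ (trans (φ-≡ is0) φ-0)
        ... | false = decide (φ c Fin.≟ 0#)
          where
          decide : Dec (φ c ≡ 0#) → Reached es (suc l) (φ c)
          decide (yes c≡0) = inj₁ c≡0
          decide (no c≢0)  = covered-reached good landed (φ-^n c) c≢0

        -- Both y^d and z ∈ η^j r lie in η^j (r + ⟨η⟩), so only sums r + η^i with r in the table matter.
        add-power : ∀ {b es} → All (Good b) es → closed hs es ≡ true → ∀ {s y z} → y ≢ 0# →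
                    Reached es s z → Reached es (suc s) (y ^ d + z)
        add-power {es = es} good eq {s} {y} y≢0 (inj₁ z≡0) =
          subst (Reached es (suc s)) (sym (trans (cong (y ^ d +_) z≡0) (+-identityʳ (y ^ d))))
            (raise-level (s≤s z≤n) (covered-reached good (proj₁ (∧-true {covered 1 es 1r} eq)) 1≡yᵈⁿ (^-nonzero d y≢0)))
          where
          1≡yᵈⁿ : φ 1r ≡ (y ^ d) ^ n
          1≡yᵈⁿ = trans φ-1 (sym (trans (^-assocʳ y d n) (fermat y≢0)))
        add-power {es = es} good eq {s} {y} {z} y≢0 (inj₂ ((l , r , v) , e∈es , l≤s , j , z≡)) =
          subst (Reached es (suc s)) (sym x≡ηʲc)
            (scale-reached {es} j (raise-level (s≤s l≤s) (landed-reached good (proj₁ (proj₂ found)))))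
          where
          coset : ∃[ i ] y ^ d ≡ η ^ toℕ {n} i * η ^ j
          coset = same-coset {y ^ d} {η ^ j} (^≡1⇒≢0 1≤n (η-power-^n j))
            (trans (trans (^-assocʳ y d n) (fermat y≢0)) (sym (η-power-^n j)))
          i = proj₁ coset
          found : ∃[ h ] lands es l (r ⊕ h) ≡ true × φ h ≡ η ^ toℕ i * φ 1r
          found = powers-sound n η̂ 1r (All.tabulate (all-true (λ h → lands es l (r ⊕ h))
            (all-true (closedUnder hs es) (proj₂ (∧-true {covered 1 es 1r} eq)) e∈es))) i
          h = proj₁ found
          c = φ (r ⊕ h)
          x≡ηʲc : y ^ d + z ≡ η ^ j * c
          x≡ηʲc = begin
            y ^ d + z                               ≡⟨ cong₂ _+_ (proj₂ coset) z≡ ⟩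
            η ^ toℕ i * η ^ j + η ^ j * φ r         ≡⟨ solve 3 (λ a b c → a :* b :+ b :* c := b :* (c :+ a)) refl (η ^ toℕ i) (η ^ j) (φ r) ⟩
            η ^ j * (φ r + η ^ toℕ i)               ≡⟨ cong (λ w → η ^ j * (φ r + w)) (trans (cong (η ^ toℕ i *_) φ-1) (*-identityʳ _)) ⟨
            η ^ j * (φ r + η ^ toℕ i * φ 1r)        ≡⟨ cong (λ w → η ^ j * (φ r + w)) (proj₂ (proj₂ found)) ⟨
            η ^ j * (φ r + φ h)                     ≡⟨ cong (η ^ j *_) (φ-+ r h) ⟨
            η ^ j * c                               ∎

        closed-sound : ∀ {b es} → All (Good b) es → closed hs es ≡ true →
                       ∀ s {x} → SumOfPowers d s x → Reached es s x
        closed-sound good eq zero    x≡0 = inj₁ x≡0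
        closed-sound {es = es} good eq (suc s) {x} (y , z , pz , x≡) =
          subst (Reached es (suc s)) (sym x≡) (decide (y Fin.≟ 0#))
          where
          decide : Dec (y ≡ 0#) → Reached es (suc s) (y ^ d + z)
          decide (no y≢0)  = add-power good eq y≢0 (closed-sound good eq s pz)
          decide (yes y≡0) = subst (Reached es (suc s))
            (sym (trans (cong (λ w → w ^ d + z) y≡0) (trans (cong (_+ z) (0^ 1≤d)) (+-identityˡ z))))
            (raise-level (ℕ.n≤1+n s) (closed-sound good eq s pz))

        -- With es′ the whole table this shows that t is no sum of powers at all; with es′ =
        -- `below m es`, that fewer than m do not suffice for t.
        avoids-sound : ∀ {b es} es′ {t} → All (Good b) es → avoids es′ t ≡ true →
                       ∀ s → (∀ e → e ∈ es → proj₁ e ≤ s → e ∈ es′) → ¬ Reached es s (φ t)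
        avoids-sound es′ {t} good eq s included (inj₁ t≡0) = isUnit-sound (proj₁ (∧-true {isUnit t} eq)) t≡0
        avoids-sound es′ {t} good eq s included (inj₂ ((l , r , v) , e∈es , l≤s , j , t≡)) =
          All.lookup (All.map⁻ (differences-sound (t ^ᵇ n₂) _ (isUnit-sound (proj₂ (∧-true {isUnit t} eq)))))
            (included _ e∈es l≤s) (begin
              φ (t ^ᵇ n₂)               ≡⟨ φ-^n t ⟩
              φ t ^ n                   ≡⟨ cong (_^ n) t≡ ⟩
              (η ^ j * φ r) ^ n         ≡⟨ ^-distrib-* (η ^ j) (φ r) n ⟩
              (η ^ j) ^ n * φ r ^ n     ≡⟨ cong (_* φ r ^ n) (η-power-^n j) ⟩
              1# * φ r ^ n              ≡⟨ *-identityˡ _ ⟩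
              φ r ^ n                   ≡⟨ proj₂ (proj₂ (All.lookup good e∈es)) ⟨
              φ v                       ∎)

        judge-sound : ∀ {b} st → All (Good b) (proj₂ st) →
                      Meaning (judge θ (powers d ω̂ 1r) hs st)
        judge-sound (suc _ , es) good = if-sound (closed hs es ∧ avoids es θ)
          (λ eq → φ θ , λ s p → avoids-sound es good (proj₂ (∧-true {closed hs es} eq)) s (λ _ e∈ _ → e∈)
                                  (closed-sound good (proj₁ (∧-true {closed hs es} eq)) s p))
          (λ _ → tt)
        judge-sound (zero , []) good = tt
        judge-sound (zero , es@((m , t , _) ∷ _)) good = if-sound (m ≤ᵇ 6)
          (λ _ → if-sound (covers ωs 6 es) (covers-sound good) (λ _ → tt))
          (λ m≰6 → if-sound (covers ωs m es ∧ (closed hs es ∧ avoids (below m es) t))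
            (λ eq → ℕ.≰⇒> (λ m≤6 → contradiction (subst T m≰6 (ℕ.≤⇒≤ᵇ m≤6)) λ ())
                  , covers-sound good (proj₁ (∧-true {covers ωs m es} eq))
                  , φ t , least (proj₂ (∧-true {covers ωs m es} eq)))
            (λ _ → tt))
          where
          ωs = powers d ω̂ 1r
          least : closed hs es ∧ avoids (below m es) t ≡ true → ∀ s → s < m → ¬ SumOfPowers d s (φ t)
          least eq s s<m p = avoids-sound (below m es) good (proj₂ (∧-true {closed hs es} eq)) s
            (λ (l , r , v) e∈ l≤s → below-sound es e∈ (ℕ.≤-<-trans l≤s s<m))
            (closed-sound good (proj₁ (∧-true {closed hs es} eq)) s p)

      verdict-sound : ∀ θ → Meaning (verdict θ)
      verdict-sound θ = go (θ ^ᵇ n₂) (θ ^ᵇ fromℕ d) (φ-^n θ) (φ-^ℕ θ d)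
        where
        go : ∀ ω η → φ ω ≡ φ θ ^ n → φ η ≡ φ θ ^ d → Meaning (verdictFor θ ω η)
        go ω η ω≡ η≡ = if-sound (hasOrder d ω ∧ hasOrder n η)
          (λ eq → let open Orders {θ} ω≡ η≡ (hasOrder-sound 1≤d (proj₁ (∧-true {hasOrder d ω} eq)))
                                            (hasOrder-sound 1≤n (proj₂ (∧-true {hasOrder d ω} eq)))
                  in judge-sound (reached hs) (proj₂ (reached-sound hs hs-powers)))
          (λ _ → tt)

-- Prime powers, and the homomorphisms from ℤ/q and F_p[X]/(f).

module Classification where
  open import Defs
  import Algebra.Properties.Semiring.Mult as SemiringMult
  open import Algebra.Bundles using (CommutativeSemiring)
  open import Data.Bool.Base using (Bool; true; false; T)
  open import Data.Bool.ListAction using (any)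
  open import Data.Fin.Base as Fin using (Fin; punchIn)
  import Data.Fin.Properties as Fin
  open import Data.List.Base as List using (List; []; _∷_; length; tabulate; upTo)
  import Data.List.Properties as List
  open import Data.List.Relation.Unary.All as All using (All; []; _∷_)
  import Data.List.Relation.Unary.All.Properties as All
  import Data.List.Relation.Unary.Unique.Propositional.Properties as Unique
  open import Data.Nat.Base as ℕ using (ℕ; zero; suc; _≤_; _<_; z≤n; s≤s; _∸_; _≡ᵇ_; _≤ᵇ_; _<ᵇ_)
  open import Data.Nat.Binary.Base as ℕᵇ using (ℕᵇ; fromℕ)
  import Data.Nat.Binary.Properties as ℕᵇ
  open import Data.Nat.Coprimality using (Coprime; coprime-divisor)
  open import Data.Nat.Divisibility using (_∣_; _∣?_; ∣1⇒≡1; m%n≡0⇒n∣m; m∣m*n; n∣m*n)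
  open import Data.Nat.DivMod using (_/_; _%_; m/n*n≡m; m≡m%n+[m/n]*n)
  open import Data.Nat.GCD using (gcd-greatest)
  open import Data.Nat.Primality using (Prime; prime⇒irreducible; ¬prime[1])
  import Data.Nat.Properties as ℕ
  open import Data.Product.Base using (_×_; _,_; proj₁; proj₂; ∃-syntax)
  open import Data.Sum.Base using (inj₁; inj₂)
  open import Data.Unit.Base using (tt)
  open import Data.Vec.Base using (Vec; []; _∷_; _∷ʳ_)
  open import Function.Base using (id)
  open import Relation.Binary.PropositionalEquality
  open import Relation.Nullary using (¬_; yes; no; contradiction)
  open CosetSearch
  open Fields
  open SearchSoundness

  ≡ᵇ-true : ∀ {m n} → (m ≡ᵇ n) ≡ true → m ≡ n
  ≡ᵇ-true {m} {n} eq = ℕ.≡ᵇ⇒≡ m n (subst T (sym eq) tt)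

  any-true : ∀ {A : Set} (p : A → Bool) xs → any p xs ≡ true → ∃[ x ] p x ≡ true
  any-true p (x ∷ xs) eq with p x in px
  ... | true  = x , px
  ... | false = any-true p xs eq

  -- If p does not divide x, then x is coprime to p and already divides the next lower power.
  prime∣divisor : ∀ {p} → Prime p → ∀ n {x} → x ∣ p ℕ.^ n → 1 < x → p ∣ x
  prime∣divisor         pr zero    x∣1  1<x = contradiction (∣1⇒≡1 x∣1) (ℕ.>⇒≢ 1<x)
  prime∣divisor {p} pr (suc n) {x} x∣pⁿ 1<x with p ∣? x
  ... | yes p∣x = p∣x
  ... | no  p∤x = prime∣divisor pr n (coprime-divisor {n = p} coprime x∣pⁿ) 1<x
    where
    coprime : Coprime x p
    coprime (d∣x , d∣p) with prime⇒irreducible pr d∣p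
    ... | inj₁ d≡1  = d≡1
    ... | inj₂ refl = contradiction d∣x p∤x

  -- Two factors of pⁿ that exceed 1 are both divisible by p, hence not coprime.
  splitsAt-sound : ∀ q a → splitsAt q a ≡ true → ¬ IsPrimePower q
  splitsAt-sound q (suc a) eq (p , n , pr , _ , q≡pⁿ) with q % suc a in q%a
  ... | zero = contradiction (subst Prime (∣1⇒≡1 p∣1) pr) ¬prime[1]
    where
    b = q / suc a
    b*a≡pⁿ : b ℕ.* suc a ≡ p ℕ.^ n
    b*a≡pⁿ = trans (m/n*n≡m (m%n≡0⇒n∣m q (suc a) q%a)) q≡pⁿ
    split₁ = ∧-true {1 <ᵇ b} eq
    split₂ = ∧-true {1 <ᵇ suc a} (proj₂ split₁)
    p∣a : p ∣ suc a
    p∣a = prime∣divisor pr n (subst (suc a ∣_) b*a≡pⁿ (n∣m*n b)) (<ᵇ-true {1} (proj₁ split₂))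
    p∣b : p ∣ b
    p∣b = prime∣divisor pr n (subst (b ∣_) b*a≡pⁿ (m∣m*n (suc a))) (<ᵇ-true {1} (proj₁ split₁))
    p∣1 : p ∣ 1
    p∣1 = subst (p ∣_) (≡ᵇ-true (proj₂ split₂)) (gcd-greatest p∣a p∣b)

  splits-sound : ∀ q → splits q ≡ true → ¬ IsPrimePower q
  splits-sound q eq with any-true (splitsAt q) (upTo 91) eq
  ... | a , eq′ = splitsAt-sound q a eq′

  module Characteristic {r : ℕ} (F : FieldOn (Fin (suc r))) where
    open FiniteFieldTheory F
    open SemiringMult (CommutativeSemiring.semiring commutativeSemiring)
      using (×-homo-+; ×1-homo-*) renaming (_×_ to _•_)

    open ≡-Reasoning

    ι : ℕ → K
    ι n = n • 1#

    ι-+ : ∀ m n → ι (m ℕ.+ n) ≡ ι m + ι n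
    ι-+ = ×-homo-+ 1#

    ι-* : ∀ m n → ι (m ℕ.* n) ≡ ι m * ι n
    ι-* = ×1-homo-*

    ι-1 : ι 1 ≡ 1#
    ι-1 = +-identityʳ 1#

    ι-^ : ∀ m n → ι (m ℕ.^ n) ≡ ι m ^ n
    ι-^ m zero    = ι-1
    ι-^ m (suc n) = trans (ι-* m (m ℕ.^ n)) (cong (ι m *_) (ι-^ m n))

    -- Translation by 1 permutes the field, so it does not change the sum of all elements.
    ι-order : ι (suc r) ≡ 0#
    ι-order = +-cancelˡ total (ι (suc r)) 0# (begin
      total + ι (suc r)                       ≡⟨ cong (total +_) (∑ᴷ.sum-replicate (suc r)) ⟨
      total + ∑ᴷ.sum {suc r} (λ _ → 1#)       ≡⟨ ∑ᴷ.∑-distrib-+ (id {A = K}) (λ _ → 1#) ⟨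
      ∑ᴷ.sum (λ x → x + 1#)                   ≡⟨ ∑ᴷ.sum-permute id (translation 1#) ⟨
      total                                   ≡⟨ +-identityʳ total ⟨
      total + 0#                              ∎)
      where total = ∑ᴷ.sum (id {A = K})

    module _ {p′ : ℕ} (ιp≡0 : ι (suc p′) ≡ 0#) where

      ι-% : ∀ a → ι (a % suc p′) ≡ ι a
      ι-% a = sym (begin
        ι a                                               ≡⟨ cong ι (m≡m%n+[m/n]*n a (suc p′)) ⟩
        ι (a % suc p′ ℕ.+ a / suc p′ ℕ.* suc p′)           ≡⟨ ι-+ (a % suc p′) _ ⟩
        ι (a % suc p′) + ι (a / suc p′ ℕ.* suc p′)         ≡⟨ cong (ι (a % suc p′) +_) (ι-* (a / suc p′) (suc p′)) ⟩
        ι (a % suc p′) + ι (a / suc p′) * ι (suc p′)       ≡⟨ cong (λ z → ι (a % suc p′) + ι (a / suc p′) * z) ιp≡0 ⟩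
        ι (a % suc p′) + ι (a / suc p′) * 0#               ≡⟨ cong (ι (a % suc p′) +_) (zeroʳ _) ⟩
        ι (a % suc p′) + 0#                               ≡⟨ +-identityʳ _ ⟩
        ι (a % suc p′)                                    ∎)

      ι-neg : ι p′ + 1# ≡ 0#
      ι-neg = trans (+-comm (ι p′) 1#) ιp≡0

      module Extension {e : ℕ} (rel : Vec ℕ (suc e)) where
        open Residues p′ rel using (Poly; addScaled; shift; const; horner; equals; shifts)

        module At (x : K) where

          value : ∀ {m} → Vec ℕ m → K
          value []               = 0#
          value {suc m} (c ∷ cs) = ι c * x ^ m + value cs

          value-∷ʳ : ∀ {m} (cs : Vec ℕ m) → value (cs ∷ʳ 0) ≡ x * value cs
          value-∷ʳ []               = trans (+-identityʳ _) (trans (zeroˡ _) (sym (zeroʳ x)))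
          value-∷ʳ {suc m} (c ∷ cs) = trans (cong (ι c * (x * x ^ m) +_) (value-∷ʳ cs))
            (solve 4 (λ c x y z → c :* (x :* y) :+ x :* z := x :* (c :* y :+ z)) refl (ι c) x (x ^ m) (value cs))

          value-addScaled : ∀ {m} a (rs cs : Vec ℕ m) → value (addScaled a rs cs) ≡ value cs + ι a * value rs
          value-addScaled a []       []       = sym (trans (+-identityˡ _) (zeroʳ (ι a)))
          value-addScaled {suc m} a (b ∷ bs) (c ∷ cs) = begin
            ι ((c ℕ.+ a ℕ.* b) % suc p′) * x ^ m + value (addScaled a bs cs)
              ≡⟨ cong₂ (λ y z → y * x ^ m + z) coefficient (value-addScaled a bs cs) ⟩
            (ι c + ι a * ι b) * x ^ m + (value cs + ι a * value bs)
              ≡⟨ solve 6 (λ c a b x u v → (c :+ a :* b) :* x :+ (u :+ a :* v) := (c :* x :+ u) :+ a :* (b :* x :+ v))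
                   refl (ι c) (ι a) (ι b) (x ^ m) (value cs) (value bs) ⟩
            ι c * x ^ m + value cs + ι a * (ι b * x ^ m + value bs) ∎
            where
            coefficient : ι ((c ℕ.+ a ℕ.* b) % suc p′) ≡ ι c + ι a * ι b
            coefficient = trans (ι-% (c ℕ.+ a ℕ.* b)) (trans (ι-+ c _) (cong (ι c +_) (ι-* a b)))

          value-const : ∀ {m} a → value (const {m} a) ≡ ι a
          value-const {zero}  a = trans (+-identityʳ _) (*-identityʳ (ι a))
          value-const {suc m} a = trans (cong₂ _+_ (zeroˡ (x * x ^ m)) (value-const {m} a)) (+-identityˡ (ι a))

          value-equals : ∀ {m} (as bs : Vec ℕ m) → equals as bs ≡ true → value as ≡ value bs
          value-equals []       []       _  = refl
          value-equals {suc m} (a ∷ as) (b ∷ bs) eq with ∧-true {a ≡ᵇ b} eq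
          ... | a≡b , as≡bs = cong₂ (λ c z → ι c * x ^ m + z) (≡ᵇ-true {a} {b} a≡b) (value-equals as bs as≡bs)

          lead : Poly → K
          lead (c ∷ _) = ι c

          -- Holds at every x, not only at roots of f, because the term lead v · (x^(e+1) - rel) is
          -- kept. `division` needs this generality; at a root the extra terms cancel.
          value-shift : ∀ v → value (shift v) + lead v * x ^ suc e ≡ x * value v + lead v * value rel
          value-shift (c ∷ cs) = begin
            value (addScaled c rel (cs ∷ʳ 0)) + ι c * (x * x ^ e)
              ≡⟨ cong (_+ ι c * (x * x ^ e)) (trans (value-addScaled c rel (cs ∷ʳ 0)) (cong (_+ ι c * value rel) (value-∷ʳ cs))) ⟩
            x * value cs + ι c * value rel + ι c * (x * x ^ e)
              ≡⟨ solve 5 (λ x v c r y → x :* v :+ c :* r :+ c :* (x :* y) := x :* (c :* y :+ v) :+ c :* r)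
                   refl x (value cs) (ι c) (value rel) (x ^ e) ⟩
            x * (ι c * x ^ e + value cs) + ι c * value rel ∎

        open At

        shifts-suc : ∀ m v → shifts m (shift v) ≡ shift (shifts m v)
        shifts-suc zero    v = refl
        shifts-suc (suc m) v = shifts-suc m (shift v)

        -- Division of x^(m+e+1) by f = x^(e+1) − rel with monic quotient cs, without subtraction.
        division : ∀ m → ∃[ cs ] length cs ≡ m × (∀ x →
          x ^ (m ℕ.+ suc e) + value x rel * eval cs x ≡ x ^ suc e * eval cs x + value x (shifts m rel))
        division zero = [] , refl , λ x → cong₂ _+_ (sym (*-identityʳ _)) (*-identityʳ _)
        division (suc m) with division m
        ... | cs , len , divides-m = lead 0# v ∷ cs , cong suc len , λ x → begin
          x * x ^ (m ℕ.+ suc e) + value x rel * (lead x v + x * eval cs x)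
            ≡⟨ solve 5 (λ x y r c g → x :* y :+ r :* (c :+ x :* g) := x :* (y :+ r :* g) :+ c :* r)
                 refl x (x ^ (m ℕ.+ suc e)) (value x rel) (lead x v) (eval cs x) ⟩
          x * (x ^ (m ℕ.+ suc e) + value x rel * eval cs x) + lead x v * value x rel
            ≡⟨ cong (λ y → x * y + lead x v * value x rel) (divides-m x) ⟩
          x * (x ^ suc e * eval cs x + value x v) + lead x v * value x rel
            ≡⟨ solve 6 (λ x y g v c r → x :* (y :* g :+ v) :+ c :* r := y :* (x :* g) :+ (x :* v :+ c :* r))
                 refl x (x ^ suc e) (eval cs x) (value x v) (lead x v) (value x rel) ⟩
          x ^ suc e * (x * eval cs x) + (x * value x v + lead x v * value x rel)
            ≡⟨ cong (x ^ suc e * (x * eval cs x) +_) (value-shift x v) ⟨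
          x ^ suc e * (x * eval cs x) + (value x (shift v) + lead x v * x ^ suc e)
            ≡⟨ solve 5 (λ x y g w c → y :* (x :* g) :+ (w :+ c :* y) := y :* (c :+ x :* g) :+ w)
                 refl x (x ^ suc e) (eval cs x) (value x (shift v)) (lead x v) ⟩
          x ^ suc e * (lead x v + x * eval cs x) + value x (shift v)
            ≡⟨ cong (λ w → x ^ suc e * (lead x v + x * eval cs x) + value x w) (shifts-suc m rel) ⟨
          x ^ suc e * (lead x v + x * eval cs x) + value x (shifts (suc m) rel) ∎
          where
          v = shifts m rel

        -- If f had no root, then the cofactor of f in x^(q−1) − 1 would vanish at all q − 1 nonzero elements.
        root : ∀ {m} → m ℕ.+ suc e ≡ r → equals (shifts m rel) (const 1) ≡ true → ∃[ x ] x ^ suc e ≡ value x rel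
        root {m} m+e≡r eq with Fin.any? (λ x → x ^ suc e Fin.≟ value x rel) | division m
        ... | yes found | _ = found
        ... | no ¬root  | cs , len , divides-m = contradiction
          (roots-bound cs (tabulate (punchIn 0#)) (Unique.tabulate⁺ (λ {i} {j} → Fin.punchIn-injective 0# i j))
            (All.tabulate⁺ (λ i → vanishes (Fin.punchInᵢ≢i 0# i))))
          (ℕ.<⇒≱ (subst₂ _<_ (sym len) (trans m+e≡r (sym (List.length-tabulate (punchIn 0#)))) (ℕ.m<m+n m (s≤s z≤n))))
          where
          vanishes : ∀ {x} → x ≢ 0# → eval cs x ≡ 0#
          vanishes {x} x≢0 with eval cs x Fin.≟ 0#
          ... | yes g≡0 = g≡0
          ... | no g≢0  = contradiction (x , sym (*-cancelˡ _ _ g≢0 (trans (*-comm g _) (trans rel*g (*-comm _ g))))) ¬root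
            where
            g = eval cs x
            rel*g : value x rel * g ≡ x ^ suc e * g
            rel*g = +-cancelˡ 1# _ _ (begin
              1# + value x rel * g                        ≡⟨ cong (_+ value x rel * g) (trans (cong (x ^_) m+e≡r) (fermat x≢0)) ⟨
              x ^ (m ℕ.+ suc e) + value x rel * g         ≡⟨ divides-m x ⟩
              x ^ suc e * g + value x (shifts m rel)      ≡⟨ cong (x ^ suc e * g +_) (trans (value-equals x (shifts m rel) (const {e} 1) eq) (trans (value-const x {e} 1) ι-1)) ⟩
              x ^ suc e * g + 1#                          ≡⟨ +-comm _ 1# ⟩
              1# + x ^ suc e * g                          ∎)

        module _ {θ : K} (θ-root : θ ^ suc e ≡ value θ rel) where

          value-shift-root : ∀ v → value θ (shift v) ≡ θ * value θ v
          value-shift-root v = +-cancelʳ (lead θ v * θ ^ suc e) _ _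
            (trans (value-shift θ v) (cong (λ y → θ * value θ v + lead θ v * y) (sym θ-root)))

          value-horner : ∀ {m} b acc (as : Vec ℕ m) →
            value θ (horner b acc as) ≡ θ ^ m * value θ acc + value θ as * value θ b
          value-horner b acc [] = sym (trans (cong₂ _+_ (*-identityˡ _) (zeroˡ _)) (+-identityʳ _))
          value-horner {suc m} b acc (a ∷ as) = begin
            value θ (horner b (addScaled a b (shift acc)) as)
              ≡⟨ value-horner b _ as ⟩
            θ ^ m * value θ (addScaled a b (shift acc)) + value θ as * value θ b
              ≡⟨ cong (λ y → θ ^ m * y + value θ as * value θ b)
                   (trans (value-addScaled θ a b (shift acc)) (cong (_+ ι a * value θ b) (value-shift-root acc))) ⟩
            θ ^ m * (θ * value θ acc + ι a * value θ b) + value θ as * value θ b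
              ≡⟨ solve 6 (λ y t u a b v → y :* (t :* u :+ a :* b) :+ v :* b := t :* y :* u :+ (a :* y :+ v) :* b)
                   refl (θ ^ m) θ (value θ acc) (ι a) (value θ b) (value θ as) ⟩
            θ * θ ^ m * value θ acc + (ι a * θ ^ m + value θ as) * value θ b ∎

  module Classification (d n : ℕ) (F : FieldOn (Fin (suc (d ℕ.* n)))) (1≤d : 1 ≤ d) (1≤n : 1 ≤ n) where
    open FiniteFieldTheory F
    open Characteristic F
    open Model d n F 1≤d 1≤n

    -- Reduction modulo q is compatible with ι because q times 1 vanishes in a field of q elements.
    modular-interpretation : Interpretation (modular (d ℕ.* n))
    modular-interpretation = record
      { φ    = ι
      ; φ-0  = refl
      ; φ-1  = ι-1
      ; φ--1 = ι-neg {d ℕ.* n} ι-order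
      ; φ-+  = λ x y → trans (ι-% {d ℕ.* n} ι-order (x ℕ.+ y)) (ι-+ x y)
      ; φ-*  = λ x y → trans (ι-% {d ℕ.* n} ι-order (x ℕ.* y)) (ι-* x y)
      ; φ-≡  = λ {x} {y} eq → cong ι (≡ᵇ-true {x} {y} eq)
      }

    extension-interpretation : ∀ {p′ e} (rel : Vec ℕ (suc e)) → suc p′ ℕ.^ suc e ≡ suc (d ℕ.* n) →
      isPrimitive (p′ , e , rel) ≡ true → Interpretation (Residues.arithmetic p′ rel)
    extension-interpretation {p′} {e} rel q≡ primitive-rel = record
      { φ    = value θ
      ; φ-0  = value-const θ {e} 0
      ; φ-1  = trans (value-const θ {e} 1) ι-1
      ; φ--1 = trans (cong (_+ 1#) (value-const θ {e} p′)) (ι-neg {p′} ιp≡0)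
      ; φ-+  = λ x y → trans (value-addScaled θ 1 x y) (trans (cong (value θ y +_)
                 (trans (cong (_* value θ x) ι-1) (*-identityˡ _))) (+-comm _ _))
      ; φ-*  = λ x y → trans (value-horner {θ} θ-root y _ x) (trans (cong (_+ value θ x * value θ y)
                 (trans (cong (θ ^ suc e *_) (value-const θ {e} 0)) (zeroʳ _))) (+-identityˡ _))
      ; φ-≡  = λ {x} {y} eq → value-equals θ x y eq
      }
      where
      -- The power p^(e+1) = q vanishes in the field, hence so does p.
      ιp≡0 : ι (suc p′) ≡ 0#
      ιp≡0 with ι (suc p′) Fin.≟ 0#
      ... | yes eq = eq
      ... | no ≢0  = contradiction (trans (sym (ι-^ (suc p′) (suc e))) (trans (cong ι q≡) ι-order)) (^-nonzero (suc e) ≢0)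
      open Extension {p′} ιp≡0 rel
      open At
      split = ∧-true {suc (suc e) ≤ᵇ suc p′ ℕ.^ suc e} primitive-rel
      found = root {suc p′ ℕ.^ suc e ∸ suc (suc e)} (ℕ.suc-injective (trans (sym (ℕ.+-suc _ (suc e)))
                (trans (ℕ.m∸n+n≡m (≤ᵇ-true (proj₁ split))) q≡))) (proj₂ split)
      θ = proj₁ found
      θ-root = proj₂ found

    module _ (n₂ q-1₂ : ℕᵇ) (n₂≡n : ℕᵇ.toℕ n₂ ≡ n) (q-1₂≡dn : ℕᵇ.toℕ q-1₂ ≡ d ℕ.* n) where

      try-sound : ∀ f g → Meaning (PrimeField.try d n n₂ q-1₂ f g)
      orTryNext-sound : ∀ f g v → Meaning v → Meaning (PrimeField.orTryNext d n n₂ q-1₂ f g v)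

      try-sound zero    g = tt
      try-sound (suc f) g = orTryNext-sound f g _
        (Soundness.verdict-sound modular-interpretation n₂ q-1₂ n₂≡n q-1₂≡dn g)

      orTryNext-sound f g notPrimePower p = p
      orTryNext-sound f g unreachable   p = p
      orTryNext-sound f g atMostSix     p = p
      orTryNext-sound f g invalid       p = try-sound f (suc g)
      orTryNext-sound f g (exactly m)   p = p

      classifyWith-sound : ∀ ext → All (λ x → isPrimitive x ≡ true) ext →
                           Meaning (classifyWith d n n₂ q-1₂ ext)
      classifyWith-sound [] _ = try-sound 60 2
      classifyWith-sound ((p′ , e , rel) ∷ ext) (valid ∷ all-valid) = if-sound (suc p′ ℕ.^ suc e ≡ᵇ suc (d ℕ.* n))
        (λ eq → Soundness.verdict-sound (extension-interpretation rel (≡ᵇ-true eq) valid) n₂ q-1₂ n₂≡n q-1₂≡dn _)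
        (λ _ → classifyWith-sound ext all-valid)

    opaque
      unfolding classify

      classify-sound : All (λ x → isPrimitive x ≡ true) extensions → IsPrimePower (suc (d ℕ.* n)) → Meaning (classify d n)
      classify-sound all-valid primePower = if-sound (splits (suc (d ℕ.* n)))
        (λ eq → splits-sound (suc (d ℕ.* n)) eq primePower)
        (λ _ → classifyWith-sound (fromℕ n) (fromℕ (d ℕ.* n)) (ℕᵇ.toℕ-fromℕ n) (ℕᵇ.toℕ-fromℕ (d ℕ.* n)) extensions all-valid)

-- Transport to `Fin`, and passage from k to gcd(k, q - 1).

module Transport where
  open import Defs
  import Algebra.Properties.Monoid.Sum as Sum
  import Algebra.Properties.Semiring.Exp as Exp
  import Algebra.Morphism.RingMonomorphism as RingMonomorphism
  open import Algebra.Apartness.Bundles using (HeytingField)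
  open import Algebra.Bundles using (CommutativeRing; RawRing)
  open import Algebra.Morphism.Structures using (IsRingMonomorphism)
  open import Data.Fin.Base as Fin using (Fin; toℕ)
  import Data.Fin.Properties as Fin
  open import Data.Nat.Base as ℕ using (ℕ; zero; suc; _≤_)
  open import Data.Nat.Divisibility using (divides)
  open import Data.Nat.GCD using (gcd; gcd-GCD; gcd[m,n]∣m; module Bézout)
  import Data.Nat.Properties as ℕ
  open import Data.Product.Base using (_,_; proj₁; ∃-syntax)
  import Data.Vec.Functional as Vector
  open import Function.Base using (_∘_)
  open import Function.Bundles using (Inverse)
  open import Level using (Level; 0ℓ)
  open import Relation.Binary.PropositionalEquality
  open import Relation.Nullary using (¬_; yes; no; contradiction)
  open Fields

  module _ {r : ℕ} {c ℓ₁ ℓ₂ : Level} (F : FiniteField (suc r) c ℓ₁ ℓ₂) (1≤r : 1 ≤ r) where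
    open FiniteField F using (heytingField; commutativeRing; enumeration)
    private
      module H = HeytingField heytingField
      module R = CommutativeRing commutativeRing
    open Inverse enumeration using (to; from; to-cong; strictlyInverseˡ; strictlyInverseʳ)
    open Exp R.semiring using () renaming (_^_ to _^ᶠ_; ^-congˡ to ^ᶠ-cong)
    open Sum R.+-monoid using (sum)

    -- On `Fin` equality is propositional and quantification over decidable predicates is decidable.
    transportedRing : RawRing 0ℓ 0ℓ
    transportedRing = record
      { Carrier = Fin (suc r)
      ; _≈_ = _≡_
      ; _+_ = λ x y → to (from x R.+ from y)
      ; _*_ = λ x y → to (from x R.* from y)
      ; -_  = λ x → to (R.- from x)
      ; 0#  = to R.0#
      ; 1#  = to R.1#
      }

    private module T = RawRing transportedRing

    from-isMonomorphism : IsRingMonomorphism transportedRing R.rawRing from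
    from-isMonomorphism = record
      { isRingHomomorphism = record
        { isSemiringHomomorphism = record
          { isNearSemiringHomomorphism = record
            { +-isMonoidHomomorphism = record
              { isMagmaHomomorphism = record
                { isRelHomomorphism = record { cong = λ { refl → R.refl } }
                ; homo = λ x y → strictlyInverseʳ _
                }
              ; ε-homo = strictlyInverseʳ _
              }
            ; *-homo = λ x y → strictlyInverseʳ _
            }
          ; 1#-homo = strictlyInverseʳ _
          }
        ; -‿homo = λ x → strictlyInverseʳ _
        }
      ; injective = from-injective
      }
      where
      from-injective : ∀ {x y} → from x R.≈ from y → x ≡ y
      from-injective {x} {y} eq = trans (sym (strictlyInverseˡ x)) (trans (to-cong eq) (strictlyInverseˡ y))

    to-+ : ∀ a b → to (a R.+ b) ≡ to a T.+ to b
    to-+ a b = to-cong (R.sym (R.+-cong (strictlyInverseʳ a) (strictlyInverseʳ b)))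

    to-* : ∀ a b → to (a R.* b) ≡ to a T.* to b
    to-* a b = to-cong (R.sym (R.*-cong (strictlyInverseʳ a) (strictlyInverseʳ b)))

    transported : FieldOn (Fin (suc r))
    transported = record
      { isCommutativeRing = T-isCommutativeRing
      ; inverse           = inverse′
      -- If 1 = 0, all elements coincide; but the first and the last differ, as r ≥ 1.
      ; 1≢0               = λ 1≡0 → contradiction (trans (x≡0 1≡0 (Fin.fromℕ r)) (sym (x≡0 1≡0 Fin.zero))) fromℕ≢0
      }
      where
      T-isCommutativeRing = RingMonomorphism.isCommutativeRing from-isMonomorphism R.isCommutativeRing
      T-commutativeRing : CommutativeRing 0ℓ 0ℓ
      T-commutativeRing = record { isCommutativeRing = T-isCommutativeRing }
      module TR = CommutativeRing T-commutativeRing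
      x≡0 : T.1# ≡ T.0# → ∀ x → x ≡ T.0#
      x≡0 1≡0 x = trans (sym (TR.*-identityʳ x)) (trans (cong (x T.*_) 1≡0) (TR.zeroʳ x))
      fromℕ≢0 : Fin.fromℕ r ≢ Fin.zero
      fromℕ≢0 eq = ℕ.>⇒≢ 1≤r (trans (sym (Fin.toℕ-fromℕ r)) (cong toℕ eq))
      inverse′ : ∀ x → x ≢ T.0# → ∃[ y ] x T.* y ≡ T.1#
      -- Inverses are given for elements apart from 0, and x ≠ 0 is weaker. Existence of an inverse
      -- is decided by finite search; if there is none, x is not apart from 0, and tightness gives x
      -- = 0.
      inverse′ x x≢0 with Fin.any? (λ y → (x T.* y) Fin.≟ T.1#)
      ... | yes found = found
      ... | no ¬found = contradiction
        (trans (sym (strictlyInverseˡ x)) (to-cong (proj₁ (H.tight (from x) R.0#) not-apart))) x≢0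
        where
        not-apart : ¬ (from x H.# R.0#)
        not-apart x#0 with H.#⇒invertible x#0
        ... | y , _ , xy≈1 = ¬found (to y , trans (sym (trans (to-* (from x) y) (cong (T._* to y) (strictlyInverseˡ x))))
          (to-cong (R.trans (R.*-congʳ (R.sym x-0≈x)) xy≈1)))
          where
          x-0≈x : from x R.- R.0# R.≈ from x
          x-0≈x = R.trans (R.+-congˡ (R.trans (R.sym (R.+-identityˡ _)) (R.-‿inverseʳ R.0#))) (R.+-identityʳ _)

    open FiniteFieldTheory transported

    to-^ : ∀ a k → to (a ^ᶠ k) ≡ to a ^ k
    to-^ a zero    = refl
    to-^ a (suc k) = trans (to-* a (a ^ᶠ k)) (cong (to a *_) (to-^ a k))

    from-^ : ∀ x k → from (x ^ k) R.≈ from x ^ᶠ k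
    from-^ x zero    = strictlyInverseʳ R.1#
    from-^ x (suc k) = R.trans (strictlyInverseʳ _) (R.*-congˡ (from-^ x k))

    to-sum : ∀ k m (v : Vector.Vector R.Carrier m) → SumOfPowers k m (to (sum (λ i → v i ^ᶠ k)))
    to-sum k zero    v = refl
    to-sum k (suc m) v = to (v Fin.zero) , _ , to-sum k m (v ∘ Fin.suc) ,
      trans (to-+ (v Fin.zero ^ᶠ k) _) (cong (_+ to (sum (λ i → v (Fin.suc i) ^ᶠ k))) (to-^ (v Fin.zero) k))

    from-sum : ∀ k m {x} → SumOfPowers k m x → IsSumOfPowers F k m (from x)
    from-sum k zero    refl = (λ ()) , R.sym (strictlyInverseʳ R.0#)
    from-sum k (suc m) (y , z , p , refl) with from-sum k m p
    ... | v , eq = (from y Vector.∷ v) , R.sym (R.trans (strictlyInverseʳ _) (R.+-cong (from-^ y k) (R.sym eq)))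

    every-to : ∀ {k m} → EveryElementIsSumOfPowers F k m → ∀ x → SumOfPowers k m x
    every-to {k} {m} every x with every (from x)
    ... | v , eq = subst (SumOfPowers k m) (trans (to-cong eq) (strictlyInverseˡ x)) (to-sum k m v)

    every-from : ∀ {k m} → (∀ x → SumOfPowers k m x) → EveryElementIsSumOfPowers F k m
    every-from {k} {m} every a with from-sum k m (every (to a))
    ... | v , eq = v , R.trans eq (strictlyInverseʳ a)

  module _ {r : ℕ} (F : FieldOn (Fin (suc r))) where
    open FiniteFieldTheory F

    sumOfPowers-map : ∀ {k l} → (∀ y → ∃[ z ] y ^ k ≡ z ^ l) → ∀ s {x} → SumOfPowers k s x → SumOfPowers l s x
    sumOfPowers-map f zero    p = p
    sumOfPowers-map f (suc s) (y , z , p , eq) with f y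
    ... | y′ , yᵏ≡ = y′ , z , sumOfPowers-map f s p , trans eq (cong (_+ z) yᵏ≡)

    ^k⇒^gcd : ∀ k y → ∃[ z ] y ^ k ≡ z ^ gcd k r
    ^k⇒^gcd k y with gcd[m,n]∣m k r
    ... | divides t k≡ = y ^ t , trans (cong (y ^_) k≡) (sym (^-assocʳ y t (gcd k r)))

    -- Bézout gives d + br = ak or d + ak = br, and exponents of a nonzero y count modulo r. So yᵈ
    -- is the k-th power of yᵃ in the first case, of y⁻ᵃ in the second.
    ^gcd⇒^k : ∀ {k} → 1 ≤ k → 1 ≤ gcd k r → ∀ y → ∃[ z ] y ^ gcd k r ≡ z ^ k
    ^gcd⇒^k {k} 1≤k 1≤d y with y Fin.≟ 0# | Bézout.identity (gcd-GCD k r)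
    ... | yes refl | _ = 0# , trans (0^ 1≤d) (sym (0^ 1≤k))
    ... | no y≢0 | Bézout.Identity.+- a b eq = y ^ a , (begin
      y ^ d                      ≡⟨ *-identityʳ _ ⟨
      y ^ d * 1#                 ≡⟨ cong (y ^ d *_) (trans (cong (_^ b) (fermat y≢0)) (1^ b)) ⟨
      y ^ d * (y ^ r) ^ b        ≡⟨ cong (y ^ d *_) (trans (^-assocʳ y r b) (cong (y ^_) (ℕ.*-comm r b))) ⟩
      y ^ d * y ^ (b ℕ.* r)      ≡⟨ ^-homo-* y d (b ℕ.* r) ⟨
      y ^ (d ℕ.+ b ℕ.* r)        ≡⟨ cong (y ^_) eq ⟩
      y ^ (a ℕ.* k)              ≡⟨ ^-assocʳ y a k ⟨
      (y ^ a) ^ k                ∎)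
      where
      open ≡-Reasoning
      d = gcd k r
    ... | no y≢0 | Bézout.Identity.-+ a b eq with inverse y y≢0
    ...   | y⁻¹ , yy⁻¹≡1 = y⁻¹ ^ a , (begin
      y ^ d                                  ≡⟨ *-identityʳ _ ⟨
      y ^ d * 1#                             ≡⟨ cong (y ^ d *_) (trans (cong (_^ (a ℕ.* k)) yy⁻¹≡1) (1^ (a ℕ.* k))) ⟨
      y ^ d * (y * y⁻¹) ^ (a ℕ.* k)          ≡⟨ cong (y ^ d *_) (^-distrib-* y y⁻¹ (a ℕ.* k)) ⟩
      y ^ d * (y ^ (a ℕ.* k) * y⁻¹ ^ (a ℕ.* k))  ≡⟨ *-assoc _ _ _ ⟨
      y ^ d * y ^ (a ℕ.* k) * y⁻¹ ^ (a ℕ.* k)    ≡⟨ cong₂ _*_ (sym (^-homo-* y d (a ℕ.* k))) (sym (^-assocʳ y⁻¹ a k)) ⟩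
      y ^ (d ℕ.+ a ℕ.* k) * (y⁻¹ ^ a) ^ k    ≡⟨ cong (λ i → y ^ i * (y⁻¹ ^ a) ^ k) (trans eq (ℕ.*-comm b r)) ⟩
      y ^ (r ℕ.* b) * (y⁻¹ ^ a) ^ k          ≡⟨ cong (_* (y⁻¹ ^ a) ^ k) (trans (sym (^-assocʳ y r b)) (trans (cong (_^ b) (fermat y≢0)) (1^ b))) ⟩
      1# * (y⁻¹ ^ a) ^ k                     ≡⟨ *-identityˡ _ ⟩
      (y⁻¹ ^ a) ^ k                          ∎)
      where
      open ≡-Reasoning
      d = gcd k r

-- Evaluation of the search.

module Verification where
  open import Defs
  open import Data.Bool.Base using (true)
  open import Data.Bool.ListAction using (all)
  open import Data.List.Base using (upTo)
  open import Relation.Binary.PropositionalEquality using (_≡_; refl)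
  open CosetSearch

  opaque
    unfolding classify

    -- Both indices are shifted by one: this covers 1 ≤ d ≤ 37 and 1 ≤ n ≤ 223.
    all-checked : checkedUpTo 223 (upTo 37) ≡ true
    all-checked = refl

    all-confirmed : all confirmed largeWaringNumbers ≡ true
    all-confirmed = refl

  all-primitive : all isPrimitive extensions ≡ true
  all-primitive = refl

-- Assembly of the classification.

open import Defs
open import Data.Bool.Base using (Bool; true; false; _∧_; _∨_; not)
open import Data.Bool.ListAction using (all; any)
open import Data.Empty using (⊥-elim)
open import Data.Fin.Base using (Fin)
open import Data.List.Base using ([]; _∷_; upTo)
open import Data.List.Membership.Propositional using (_∈_)
open import Data.List.Membership.Propositional.Properties using (∈-upTo⁺)
open import Data.List.Relation.Unary.All as All using (All)
open import Data.List.Relation.Unary.Any using (here; there)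
open import Data.Nat.Base
open import Data.Nat.Divisibility using (divides; ∣⇒≤)
open import Data.Nat.DivMod using (m*n/n≡m)
open import Data.Nat.GCD using (gcd; gcd[m,n]∣m; gcd[m,n]∣n)
open import Data.Nat.Primality using (¬prime[0]; ¬prime[1])
import Data.Nat.Properties as ℕ
open import Data.Product.Base using (_×_; _,_; proj₁; ∃-syntax)
open import Function.Bundles using (_⇔_; mk⇔)
open import Level using (Level)
open import Relation.Binary.PropositionalEquality
open import Relation.Nullary using (yes; no; contradiction)
open CosetSearch
open Fields
open SearchSoundness
open Classification
open SixPowers
open Transport
open Verification

∨-elimˡ : ∀ {a b} → a ∨ b ≡ true → a ≡ false → b ≡ true
∨-elimˡ eq refl = eq

≡ᵇ-refl : ∀ n → (n ≡ᵇ n) ≡ true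
≡ᵇ-refl zero    = refl
≡ᵇ-refl (suc n) = ≡ᵇ-refl n

<ᵇ-false : ∀ {m n} → n ≤ m → (m <ᵇ n) ≡ false
<ᵇ-false {m} {n} n≤m with m <ᵇ n in eq
... | true  = contradiction n≤m (ℕ.<⇒≱ (<ᵇ-true eq))
... | false = refl

listed-sound : ∀ {k q m} → listed k q m ≡ true → (k , q , m) ∈ largeWaringNumbers
listed-sound {k} {q} {m} = go largeWaringNumbers
  where
  go : ∀ xs → any (λ (k′ , q′ , m′) → (k ≡ᵇ k′) ∧ (q ≡ᵇ q′) ∧ (m ≡ᵇ m′)) xs ≡ true → (k , q , m) ∈ xs
  go ((k′ , q′ , m′) ∷ xs) eq with (k ≡ᵇ k′) ∧ (q ≡ᵇ q′) ∧ (m ≡ᵇ m′) in this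
  ... | false = there (go xs eq)
  ... | true with ∧-true {k ≡ᵇ k′} this
  ...   | k≡ , rest with ∧-true {q ≡ᵇ q′} rest
  ...     | q≡ , m≡ = here (cong₂ _,_ (≡ᵇ-true {k} k≡) (cong₂ _,_ (≡ᵇ-true {q} q≡) (≡ᵇ-true {m} m≡)))

acceptable-listed : ∀ {d n m k} → acceptable d n (exactly m) ≡ true → 4 ≤ k → k ≤ 37 → gcd k (d * n) ≡ d →
                    (k , suc (d * n) , m) ∈ largeWaringNumbers
acceptable-listed {d} {n} {m} {k} eq 4≤k k≤37 gcd≡d = listed-sound {k} {suc (d * n)} {m}
  (∨-elimˡ {not (gcd k (d * n) ≡ᵇ d)}
    (∨-elimˡ {k <ᵇ 4} (all-true (λ k → (k <ᵇ 4) ∨ not (gcd k (d * n) ≡ᵇ d) ∨ listed k (suc (d * n)) m) eq (∈-upTo⁺ (s≤s k≤37)))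
      (<ᵇ-false 4≤k))
    (cong not (trans (cong (_≡ᵇ d) gcd≡d) (≡ᵇ-refl d))))

isExactly-sound : ∀ v {m} → isExactly m v ≡ true → v ≡ exactly m
isExactly-sound (exactly m′) {m} eq = cong exactly (sym (≡ᵇ-true {m} eq))

confirmed-sound : ∀ {k r m d n} → gcd k r ≡ d → cofactor d r ≡ n → confirmed (k , suc r , m) ≡ true →
                  classify d n ≡ exactly m
confirmed-sound {d = d} {n} refl refl eq = isExactly-sound (classify d n) eq

checkedUpTo-sound : ∀ b ds → checkedUpTo b ds ≡ true → ∀ {d n} → d ∈ ds → n < b → checked (suc d) (suc n) ≡ true
checkedUpTo-sound b ds eq {d} d∈ds n<b =
  all-true (λ n → checked (suc d) (suc n)) (all-true (λ d → all (λ n → checked (suc d) (suc n)) (upTo b)) eq d∈ds) (∈-upTo⁺ n<b)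

all⇒All : ∀ {A : Set} (p : A → Bool) xs → all p xs ≡ true → All (λ x → p x ≡ true) xs
all⇒All p xs eq = All.tabulate (all-true p eq)

-- The extreme case is 37² · 36 = 49284 < 50400 = 224 · 225.
large-n : ∀ {d n} → d ≤ 36 → 223 ≤ n → suc d * suc d * d < suc n * suc (suc n)
large-n {d} {n} d≤36 223≤n = ℕ.≤-<-trans
  (ℕ.*-mono-≤ (ℕ.*-mono-≤ (s≤s d≤36) (s≤s d≤36)) d≤36)
  (ℕ.<-≤-trans (<ᵇ-true {37 * 37 * 36} {224 * 225} refl) (ℕ.*-mono-≤ (s≤s 223≤n) (s≤s (s≤s 223≤n))))

module _ {d′ n′ : ℕ} (F : FieldOn (Fin (suc (suc d′ * suc n′)))) (primePower : IsPrimePower (suc (suc d′ * suc n′))) where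
  private
    d = suc d′
    n = suc n′
  open FiniteFieldTheory F using (SumOfPowers)
  open Model d n F (s≤s z≤n) (s≤s z≤n) using (Meaning)

  classify-meaning : Meaning (classify d n)
  classify-meaning = Classification.classify-sound d n F (s≤s z≤n) (s≤s z≤n) (all⇒All isPrimitive extensions all-primitive) primePower

  -- Where the energy method applies, the verdict `atMostSix` holds without evaluation; so both
  -- cases continue with a verdict.
  dichotomy : d′ ≤ 36 → ∃[ v ] Meaning v × acceptable d n v ≡ true
  dichotomy d′≤36 with suc d′ * suc d′ * d′ ℕ.<? suc n′ * suc (suc n′)
  ... | yes large = atMostSix , ManyElements.six-powers {d′} {suc n′} F (s≤s z≤n) large , refl
  ... | no ¬large = classify d n , classify-meaning ,
    ∨-elimˡ (checkedUpTo-sound 223 (upTo 37) all-checked (∈-upTo⁺ (s≤s d′≤36)) n′<223) (<ᵇ-false (ℕ.≮⇒≥ ¬large))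
    where
    n′<223 : n′ < 223
    n′<223 = ℕ.≰⇒> (λ 223≤n′ → ¬large (large-n d′≤36 223≤n′))

module _ {c ℓ₁ ℓ₂ : Level} {d′ n′ k : ℕ} (1≤k : 1 ≤ k) (gcd≡d : gcd k (suc d′ * suc n′) ≡ suc d′)
         (F : FiniteField (suc (suc d′ * suc n′)) c ℓ₁ ℓ₂) (primePower : IsPrimePower (suc (suc d′ * suc n′))) where
  private
    d = suc d′
    n = suc n′
    r = d * n
    K = transported F (s≤s z≤n)
  open FiniteFieldTheory K using (SumOfPowers)
  open Model d n K (s≤s z≤n) (s≤s z≤n) using (Meaning)

  every⇒ : ∀ {m} → EveryElementIsSumOfPowers F k m → ∀ x → SumOfPowers d m x
  every⇒ {m} every x = subst (λ e → SumOfPowers e m x) gcd≡d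
    (sumOfPowers-map K {k} {gcd k r} (^k⇒^gcd K k) m (every-to F (s≤s z≤n) {k} {m} every x))

  every⇐ : ∀ {m} → (∀ x → SumOfPowers d m x) → EveryElementIsSumOfPowers F k m
  every⇐ {m} every = every-from F (s≤s z≤n) {k} {m} (λ x →
    sumOfPowers-map K {gcd k r} {k} (^gcd⇒^k K 1≤k (subst (1 ≤_) (sym gcd≡d) (s≤s z≤n))) m
      (subst (λ e → SumOfPowers e m x) (sym gcd≡d) (every x)))

  exactly⇒waring : ∀ {m} → Meaning (exactly m) → IsWaringNumber F k m
  exactly⇒waring (7≤m , every , t , least) = record
    { positive   = ℕ.≤-trans (s≤s z≤n) 7≤m
    ; sufficient = every⇐ every
    ; least      = λ s _ every-s → ℕ.≮⇒≥ (λ s<m → least s s<m (every⇒ every-s t))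
    }

  waring-unique : ∀ {m m′} → IsWaringNumber F k m → IsWaringNumber F k m′ → m ≡ m′
  waring-unique w w′ = ℕ.≤-antisym (W.least _ W′.positive W′.sufficient) (W′.least _ W.positive W.sufficient)
    where
    module W = IsWaringNumber w
    module W′ = IsWaringNumber w′

  large⇒listed : 4 ≤ k → k ≤ 37 → ∀ {m} → IsWaringNumber F k m → 7 ≤ m → (k , suc r , m) ∈ largeWaringNumbers
  large⇒listed 4≤k k≤37 {m} w 7≤m with dichotomy K primePower d′≤36
    where
    d′≤36 : d′ ≤ 36
    d′≤36 = s≤s⁻¹ (ℕ.≤-trans (subst (_≤ k) gcd≡d (∣⇒≤ {{>-nonZero 1≤k}} (gcd[m,n]∣m k r))) k≤37)
  ... | notPrimePower , absurd , _ = ⊥-elim absurd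
  ... | invalid , _ , ()
  ... | unreachable , (t , ¬sum) , _ = contradiction (every⇒ (IsWaringNumber.sufficient w) t) (¬sum m)
  ... | atMostSix , six , _ = contradiction (IsWaringNumber.least w 6 (s≤s z≤n) (every⇐ six)) (ℕ.<⇒≱ 7≤m)
  ... | exactly m′ , meaning , acc = subst (λ m → (k , suc r , m) ∈ largeWaringNumbers)
    (waring-unique (exactly⇒waring meaning) w) (acceptable-listed {d} {n} {m′} acc 4≤k k≤37 gcd≡d)

  listed⇒large : ∀ {m} → (k , suc r , m) ∈ largeWaringNumbers → IsWaringNumber F k m × 7 ≤ m
  listed⇒large {m} entry∈ = exactly⇒waring meaning , proj₁ meaning
    where
    cofactor≡n : cofactor d r ≡ n
    cofactor≡n = trans (cong (_/ d) (ℕ.*-comm d n)) (m*n/n≡m n d)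
    meaning : Meaning (exactly m)
    meaning = subst Meaning
      (confirmed-sound {k} {r} gcd≡d cofactor≡n (all-true confirmed {largeWaringNumbers} all-confirmed entry∈))
      (classify-meaning K primePower)

prime-power-≥2 : ∀ {q} → IsPrimePower q → 2 ≤ q
prime-power-≥2 (zero , _ , pr , _) = contradiction pr ¬prime[0]
prime-power-≥2 (1 , _ , pr , _)    = contradiction pr ¬prime[1]
prime-power-≥2 (p@(suc (suc p-2)) , suc n , _ , _ , refl) =
  ℕ.*-mono-≤ {2} {p} {1} {p ^ n} (s≤s (s≤s z≤n)) (ℕ.m^n>0 p n)

-- With gcd k r in place of the variable d, the equation r = dn would contain r on both sides and
-- could not be matched.
large⇔listed : ∀ {c ℓ₁ ℓ₂ : Level} {k d n r : ℕ} → gcd k r ≡ d → r ≡ d * n → 1 ≤ r → 4 ≤ k → k ≤ 37 → IsPrimePower (suc r) →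
    (F : FiniteField (suc r) c ℓ₁ ℓ₂) (m : ℕ) →
    (IsWaringNumber F k m × 7 ≤ m) ⇔ ((k , suc r , m) ∈ largeWaringNumbers)
large⇔listed {d = zero} _ refl () 4≤k k≤37 primePower F m
large⇔listed {d = suc d} {n = zero} _ refl 1≤r 4≤k k≤37 primePower F m = contradiction (subst (1 ≤_) (ℕ.*-zeroʳ d) 1≤r) λ ()
large⇔listed {d = suc d} {n = suc n} gcd≡d refl 1≤r 4≤k k≤37 primePower F m = mk⇔
  (λ (w , 7≤m) → large⇒listed 1≤k gcd≡d F primePower 4≤k k≤37 w 7≤m)
  (listed⇒large 1≤k gcd≡d F primePower)
  where 1≤k = ℕ.≤-trans (s≤s z≤n) 4≤k

theorem3p8 : ∀ {c ℓ₁ ℓ₂ : Level} (k q : ℕ) → 4 ≤ k → k ≤ 37 → IsPrimePower q →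
    (F : FiniteField q c ℓ₁ ℓ₂) (m : ℕ) →
    (IsWaringNumber F k m × 7 ≤ m) ⇔ ((k , q , m) ∈ largeWaringNumbers)
theorem3p8 k zero    4≤k k≤37 primePower F m = contradiction (prime-power-≥2 primePower) λ ()
theorem3p8 k (suc r) 4≤k k≤37 primePower F m with gcd[m,n]∣n k r
... | divides n r≡n*d = large⇔listed refl (trans r≡n*d (ℕ.*-comm n _)) (s≤s⁻¹ (prime-power-≥2 primePower)) 4≤k k≤37 primePower F m
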